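{- For all positive integers $d,k,t,\delta,\lambda,\theta$ with $\delta\geq 2$, there exists a positive integer $k_1=k_1(d,k,t,\delta,\lambda,\theta)$ with the following property. Let $G$ be a $t$-clean graph and let $B_1$ be a strong $k_1$-block in $G$. Then there exist $A\subseteq V(G)$ and $S\subseteq B_1\setminus A$ such that: (1) $S$ is both a strong $k$-block and a $d$-stable set in $G\setminus A$; (2) $G\setminus A$ has an induced subgraph $F'$ isomorphic to $\theta S_{\delta,\lambda}$ together with a choice of roots making $F'$ a rooted subdivided star forest with all roots in $S$; (3) $G\setminus A$ contains a hole of length greater than $\lambda$. In particular, every $t$-clean graph with no induced subgraph isomorphic to $\theta S_{\delta,\lambda}$, and every $t$-clean graph with no hole of length greater than $\lambda$, has no strong $k_1$-block.
   Context: All graphs are finite and simple; a path in $G$ means an induced subgraph of $G$ that is a path; length = number of edges; a hole is an induced cycle of length at least four. A strong $k$-block in $G$ is a set $B$ of at least $k$ vertices of $G$ such that for every $2$-subset $\{x,y\}$ of $B$ there is a collection $\mathcal{P}_{\{x,y\}}$ of at least $k$ distinct, pairwise internally disjoint paths in $G$ from $x$ to $y$, where for any two distinct $2$-subsets $\{x,y\},\{x',y'\}\subseteq B$ and any $P\in\mathcal{P}_{\{x,y\}}$, $P'\in\mathcal{P}_{\{x',y'\}}$ we have $V(P)\cap V(P')=\{x,y\}\cap\{x',y'\}$. A $d$-stable set in $G$ is a set $S\subseteq V(G)$ such that no two distinct vertices of $S$ are joined by a path of length at most $d$ in $G$. For integers $\delta\geq 0,\lambda\geq1$, $S_{\delta,\lambda}$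 is the $(\lambda-1)$-subdivision of $K_{1,\delta}$ (every edge replaced by a path of length $\lambda$), and $\theta S_{\delta,\lambda}$ is the disjoint union of $\theta$ copies of it. A subdivided star is a tree with at most one vertex of degree more than two; a rooted subdivided star is one with a chosen root which, if the tree is not a path, is its unique vertex of degree more than two; a rooted subdivided star forest is a forest whose components are rooted subdivided stars. For $t\geq 1$ the $t$-basic obstructions are $K_t$, $K_{t,t}$, every subdivision of the standard $(t\times t)$-wall $W_{t\times t}$ (a planar hexagonal-grid-like graph of maximum degree three on $2t^2-2t$ vertices) and the line graph of every such subdivision; a graph is $t$-clean if it has no induced subgraph isomorphic to a $t$-basic obstruction. -}

module Defs where

open import Data.Nat using (ℕ; zero; suc; _+_; _∸_; _*_; _≤_; _<_; _%_; _≡ᵇ_)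
open import Data.Fin using (Fin; zero; suc; toℕ; fromℕ; inject₁)
open import Data.Fin.Subset using (Subset; _∈_; ∣_∣; ⊤)
open import Data.Bool using (Bool; true; false; T; _∧_; _∨_; not)
open import Data.Maybe using (Maybe; just; nothing)
open import Data.Product using (Σ; ∃; _×_; _,_; proj₁; proj₂)
open import Data.Sum using (_⊎_; inj₁; inj₂)
open import Data.Unit using () renaming (⊤ to Unit)
open import Data.Empty using (⊥)
open import Relation.Nullary using (¬_)
open import Relation.Binary.PropositionalEquality using (_≡_; _≢_)
open import Function.Bundles using (_⇔_)

record Graph : Set where
  field
    n      : ℕ
    adj    : Fin n → Fin n → Bool
    sym    : ∀ u v → adj u v ≡ adj v u
    irrefl : ∀ v → adj v v ≡ false

open Graph public

Adj : (G : Graph) → Fin (n G) → Fin (n G) → Set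
Adj G u v = T (adj G u v)

-- Throughout, notions "in G[U]" (the induced subgraph of G on U) are
-- expressed by a vertex set U : Subset (n G).  G itself is G[⊤] and
-- G ∖ A is G[∁ A].

record IPath (G : Graph) (U : Subset (n G)) (x y : Fin (n G)) : Set where
  field
    len    : ℕ
    vx     : Fin (suc len) → Fin (n G)
    inj    : ∀ i j → vx i ≡ vx j → i ≡ j
    start  : vx zero ≡ x
    end    : vx (fromℕ len) ≡ y
    inU    : ∀ i → vx i ∈ U
    adjIff : ∀ i j → Adj G (vx i) (vx j) ⇔
                     ((suc (toℕ i) ≡ toℕ j) ⊎ (suc (toℕ j) ≡ toℕ i))

open IPath public

OnPath : {G : Graph} {U : Subset (n G)} {x y : Fin (n G)} →
         Fin (n G) → IPath G U x y → Set
OnPath v P = ∃ λ i → vx P i ≡ v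

In2 : {A : Set} → A → A → A → Set
In2 v x y = (v ≡ x) ⊎ (v ≡ y)

-- A strong k-block in G[U].  For every 2-subset {x,y} of B (listed as
-- x < y) we are given k paths coll x y … 0, …, coll x y … (k-1)
-- (a sub-collection of size exactly k of a collection of size ≥ k).
StrongBlock : (G : Graph) (U : Subset (n G)) (k : ℕ) (B : Subset (n G)) → Set
StrongBlock G U k B =
  k ≤ ∣ B ∣ ×
  Σ ((x y : Fin (n G)) → x ∈ B → y ∈ B → toℕ x < toℕ y → Fin k → IPath G U x y)
    λ coll →
      (∀ x y (hx : x ∈ B) (hy : y ∈ B) (lt : toℕ x < toℕ y) (i j : Fin k) → i ≢ j →
         (¬ (∀ v → OnPath v (coll x y hx hy lt i) ⇔ OnPath v (coll x y hx hy lt j))) ×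
         (∀ v → (OnPath v (coll x y hx hy lt i) × OnPath v (coll x y hx hy lt j))
                ⇔ In2 v x y)) ×
      (∀ x y x' y' (hx : x ∈ B) (hy : y ∈ B) (lt : toℕ x < toℕ y)
         (hx' : x' ∈ B) (hy' : y' ∈ B) (lt' : toℕ x' < toℕ y') →
         (x ≢ x' ⊎ y ≢ y') → (i j : Fin k) →
         ∀ v → (OnPath v (coll x y hx hy lt i) × OnPath v (coll x' y' hx' hy' lt' j))
               ⇔ (In2 v x y × In2 v x' y'))

Stable : (G : Graph) (U : Subset (n G)) (d : ℕ) (S : Subset (n G)) → Set
Stable G U d S =
  ∀ x y → x ∈ S → y ∈ S → x ≢ y → ¬ (Σ (IPath G U x y) λ P → len P ≤ d)

CycNext : {L : ℕ} → Fin L → Fin L → Set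
CycNext {L} i j = (suc (toℕ i) ≡ toℕ j) ⊎ ((suc (toℕ i) ≡ L) × (toℕ j ≡ 0))

record Hole (G : Graph) (U : Subset (n G)) : Set where
  field
    L      : ℕ
    four   : 4 ≤ L
    cyc    : Fin L → Fin (n G)
    inj    : ∀ i j → cyc i ≡ cyc j → i ≡ j
    inU    : ∀ i → cyc i ∈ U
    adjIff : ∀ i j → Adj G (cyc i) (cyc j) ⇔ (CycNext i j ⊎ CycNext j i)

record Pattern : Set₁ where
  field
    V   : Set
    PAdj : V → V → Set

open Pattern public

record InducedCopy (G : Graph) (U : Subset (n G)) (H : Pattern) : Set where
  field
    emb    : V H → Fin (n G)
    inj    : ∀ a b → emb a ≡ emb b → a ≡ b
    inU    : ∀ a → emb a ∈ U
    adjIff : ∀ a b → PAdj H a b ⇔ Adj G (emb a) (emb b)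

open InducedCopy public

record EdgeGraph : Set₁ where
  field
    EV   : Set
    EE   : Set
    tl   : EE → EV
    hd   : EE → EV

open EdgeGraph public

toPattern : EdgeGraph → Pattern
toPattern H = record
  { V = EV H
  ; PAdj = λ u v → ∃ λ e → ((tl H e ≡ u) × (hd H e ≡ v)) ⊎ ((tl H e ≡ v) × (hd H e ≡ u)) }

lineGraph : EdgeGraph → Pattern
lineGraph H = record
  { V = EE H
  ; PAdj = λ e f → (e ≢ f) × (∃ λ x → In2 x (tl H e) (hd H e) × In2 x (tl H f) (hd H f)) }

pathPt : {A : Set} (m : ℕ) → A → A → (Fin m → A) → Fin (suc (suc m)) → A
pathPt m a b f zero = a
pathPt zero a b f (suc zero) = b
pathPt (suc m) a b f (suc k) = pathPt m (f zero) b (λ i → f (suc i)) k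

subdivide : (H : EdgeGraph) → (EE H → ℕ) → EdgeGraph
subdivide H m = record
  { EV = EV H ⊎ Σ (EE H) (λ e → Fin (m e))
  ; EE = Σ (EE H) (λ e → Fin (suc (m e)))
  ; tl = λ es → pt (proj₁ es) (inject₁ (proj₂ es))
  ; hd = λ es → pt (proj₁ es) (suc (proj₂ es))
  }
  where
    pt : (e : EE H) → Fin (suc (suc (m e))) → EV H ⊎ Σ (EE H) (λ e → Fin (m e))
    pt e = pathPt (m e) (inj₁ (tl H e)) (inj₁ (hd H e)) (λ k → inj₂ (e , k))

-- The (t × t)-wall.  Grid positions (i , j), rows i < t, columns j < 2t.
-- Horizontal edges (i,j)(i,j+1); vertical edges (i,j)(i+1,j) when i + j
-- is even; finally the (two) vertices of degree one are deleted:
-- (0, 2t-1) and (t-1, 0) if t is odd, (t-1, 2t-1) if t is even.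

Pos : ℕ → Set
Pos t = Fin t × Fin (t + t)

keep : (t : ℕ) → Pos t → Bool
keep t (i , j) =
  not ((toℕ i ≡ᵇ 0) ∧ (toℕ j ≡ᵇ (t + t ∸ 1))) ∧
  not ((suc (toℕ i) ≡ᵇ t) ∧
       (((t % 2 ≡ᵇ 1) ∧ (toℕ j ≡ᵇ 0)) ∨ ((t % 2 ≡ᵇ 0) ∧ (toℕ j ≡ᵇ (t + t ∸ 1)))))

wallEdge : (t : ℕ) → Pos t → Pos t → Bool
wallEdge t (i , j) (i' , j') =
  ((toℕ i ≡ᵇ toℕ i') ∧ (suc (toℕ j) ≡ᵇ toℕ j')) ∨
  ((toℕ j ≡ᵇ toℕ j') ∧ (suc (toℕ i) ≡ᵇ toℕ i') ∧ ((toℕ i + toℕ j) % 2 ≡ᵇ 0))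

WallV : ℕ → Set
WallV t = Σ (Pos t) (λ p → T (keep t p))

WallE : ℕ → Set
WallE t = Σ (WallV t × WallV t) (λ uv → T (wallEdge t (proj₁ (proj₁ uv)) (proj₁ (proj₂ uv))))

wall : ℕ → EdgeGraph
wall t = record
  { EV = WallV t
  ; EE = WallE t
  ; tl = λ e → proj₁ (proj₁ e)
  ; hd = λ e → proj₂ (proj₁ e)
  }

complete : ℕ → Pattern
complete t = record { V = Fin t ; PAdj = λ a b → a ≢ b }

completeBip : ℕ → Pattern
completeBip t = record { V = Fin t ⊎ Fin t ; PAdj = cross }
  where
    cross : Fin t ⊎ Fin t → Fin t ⊎ Fin t → Set
    cross (inj₁ _) (inj₂ _) = Unit
    cross (inj₂ _) (inj₁ _) = Unit
    cross (inj₁ _) (inj₁ _) = ⊥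
    cross (inj₂ _) (inj₂ _) = ⊥

Clean : ℕ → Graph → Set
Clean t G =
  ¬ InducedCopy G ⊤ (complete t) ×
  ¬ InducedCopy G ⊤ (completeBip t) ×
  (∀ (m : EE (wall t) → ℕ) → ¬ InducedCopy G ⊤ (toPattern (subdivide (wall t) m))) ×
  (∀ (m : EE (wall t) → ℕ) → ¬ InducedCopy G ⊤ (lineGraph (subdivide (wall t) m)))

-- θ S_{δ,l}: θ disjoint copies of the (l-1)-subdivision of K_{1,δ}.
-- Vertex (c , nothing) is the centre of copy c; (c , just (a , j)) is the
-- vertex at distance j+1 from the centre on leg a of copy c.

StarV : ℕ → ℕ → Set
StarV δ l = Maybe (Fin δ × Fin l)

starAdj : {δ l : ℕ} → StarV δ l → StarV δ l → Set
starAdj nothing nothing = ⊥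
starAdj nothing (just (a , j)) = toℕ j ≡ 0
starAdj (just (a , j)) nothing = toℕ j ≡ 0
starAdj (just (a , j)) (just (a' , j')) =
  (a ≡ a') × ((suc (toℕ j) ≡ toℕ j') ⊎ (suc (toℕ j') ≡ toℕ j))

starForest : (θ δ l : ℕ) → Pattern
starForest θ δ l = record
  { V = Fin θ × StarV δ l
  ; PAdj = λ p q → (proj₁ p ≡ proj₁ q) × starAdj (proj₂ p) (proj₂ q) }

-- A valid root of the rooted subdivided star S_{δ,l}: any vertex if the
-- tree is a path (δ ≤ 2), otherwise its unique vertex of degree > 2,
-- the centre.
ValidRoot : (δ l : ℕ) → StarV δ l → Set
ValidRoot δ l r = (δ ≤ 2) ⊎ (r ≡ nothing)

RootedStarForestIn : (G : Graph) (U : Subset (n G)) (θ δ l : ℕ) (S : Subset (n G)) → Set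
RootedStarForestIn G U θ δ l S =
  Σ (InducedCopy G U (starForest θ δ l)) λ F →
  Σ (Fin θ → StarV δ l) λ root →
    ∀ c → ValidRoot δ l (root c) × (emb F (c , root c) ∈ S)

{-# OPTIONS --safe #-}

-- Key fact: in a t-clean graph no large set W has all its pairs robustly linked, i.e. joined by
-- a walk of length at most d avoiding any prescribed small vertex set.  Otherwise one greedily
-- gets a subdivided complete graph on W with disjoint short routes.  By Ramsey's theorem for
-- 4-tuples the adjacencies between its vertices may be assumed to depend only on the order type
-- of the indices; an edge outside the routes then repeats into a large biclique, which is
-- excluded together with large cliques, so the subdivision is induced and contains a subdivided
-- wall.
--
-- (1) By Ramsey's theorem and the key fact a large part of the block consists of pairs whose short
-- connections are killed by bounded vertex sets.  A further Ramsey argument (a free set) makes these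
-- killing sets avoid the chosen vertices, and deleting them destroys few paths of the block.
-- (2) At each root take the beginnings of many block paths; by Ramsey and the exclusion of
-- bicliques many of them are pairwise anticomplete, and stability keeps different stars apart.
-- (3) Let a₁, a₂, … be the second vertices of many disjoint paths from x to y.  A shortest path from
-- aᵢ to aⱼ outside the neighbourhood of x closes to a hole through x.  If all these holes are short, a
-- sunflower argument gives a hub joined to many aᵢ by short disjoint paths; deleting hubs and
-- repeating yields many hubs with common ends, a robustly linked set, contradicting the key fact.
module Submission where

open import Defs hiding (sym)
open import Data.Bool using (Bool; true; false; T) renaming (_≟_ to _≟ᵇ_)
open import Data.Bool.Properties using (T?; T-∧; T-∨; T-irrelevant; T-≡; ¬-not)
open import Data.Empty using (⊥; ⊥-elim)
open import Data.Fin using (Fin; zero; suc; toℕ; fromℕ; inject₁; inject≤; combine; _≟_)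
open import Data.Fin.Properties using (toℕ<n; toℕ-injective; toℕ-inject₁; inject≤-injective; combine-injective; any?) renaming (suc-injective to Fin-suc-injective)
open import Data.Fin.Subset using (Subset; ⊤; ∁; _⊆_; _─_; ∣_∣)
import Data.Fin.Subset as Sub
open import Data.Fin.Subset.Properties using (∈⊤; x∈∁p⇒x∉p; x∉p⇒x∈∁p; x∈p∧x∉q⇒x∈p─q)
open import Data.List using (List; []; _∷_; _++_; length; map; filter; take; drop; tabulate; concatMap; cartesianProduct; cartesianProductWith; allFin; upTo; lookup)
import Data.List.Membership.DecPropositional as DecMembership
open import Data.List.Membership.Propositional using (_∈_; _∉_; lose; find)
open import Data.List.Membership.Propositional.Properties using (∈-filter⁺; ∈-filter⁻; ∈-tabulate⁻; ∈-++⁻; ∈-++⁺ˡ; ∈-++⁺ʳ; ∈-map⁺; ∈-map⁻; ∈-concatMap⁺; ∈-concatMap⁻; ∈-cartesianProduct⁺; ∈-cartesianProduct⁻; ∈-cartesianProductWith⁺; ∈-upTo⁺; ∈-upTo⁻; ∈-allFin; ∈-lookup)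
open import Data.List.Properties using (take++drop≡id; length-take; length-drop; length-map; length-++; length-tabulate; length-filter; filter-all)
open import Data.List.Relation.Binary.Sublist.Propositional using ([]; _∷_; _∷ʳ_; minimum; from∈) renaming (_⊆_ to _⊑_; ⊆-refl to ⊑-refl; ⊆-trans to ⊑-trans; lookup to ⊑⇒∈)
open import Data.List.Relation.Binary.Sublist.Propositional.Properties using (filter-⊆; All-resp-⊆; ++⁺; drop-⊆; take-⊆; map⁺)
open import Data.List.Relation.Unary.All as All using (All; []; _∷_)
import Data.List.Relation.Unary.All.Properties as AllP
open import Data.List.Relation.Unary.AllPairs as AllPairs using (AllPairs; []; _∷_)
import Data.List.Relation.Unary.AllPairs.Properties as AllPairsP
open import Data.List.Relation.Unary.Any as Any using (Any; here; there)
open import Data.List.Relation.Unary.Unique.Propositional using (Unique)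
import Data.List.Relation.Unary.Unique.Propositional.Properties as UniqueP
open import Data.Maybe using (Maybe; just; nothing; fromMaybe)
open import Data.Maybe.Properties using (just-injective)
open import Data.Nat using (ℕ; zero; suc; _+_; _*_; _≤_; _<_; _⊔_; _≤?_; z≤n; s≤s; s≤s⁻¹)
open import Data.Nat.Properties using (≤-refl; ≤-trans; ≤-reflexive; ≤-antisym; +-suc; +-comm; +-monoˡ-≤; +-monoʳ-≤; +-mono-≤; *-monoˡ-≤; *-monoʳ-≤; *-mono-≤; +-cancelˡ-≤; +-cancelʳ-≤; m≤m+n; m≤n+m; m≤m⊔n; m≤n⊔m; ⊓-glb; m⊓n≤m; m≤n⇒m⊓n≡m; m+n≤o⇒m≤o∸n; ≰⇒>; <⇒≤; <⇒≢; ≤⇒≯; <-irrefl; n≤1+n; 1+n≢n; suc-injective; ≡ᵇ⇒≡; *-suc)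
open import Data.Product using (Σ; ∃; ∃₂; _×_; _,_; proj₁; proj₂)
open import Data.Product.Properties using (≡-dec)
open import Data.Sum using (_⊎_; inj₁; inj₂; [_,_]′; swap)
open import Data.Unit using (tt) renaming (⊤ to Unit)
open import Data.Vec using (Vec; []; _∷_; toList; _[_]≔_)
import Data.Vec as Vec
open import Data.Vec.Properties using (lookup∘update; lookup∘update′; lookup∘tabulate; toList∘fromList; []=⇒lookup; lookup⇒[]=)
open import Function using (_∘_; _⇔_; mk⇔; Equivalence)
open import Relation.Binary using (DecidableEquality)
open import Relation.Binary.PropositionalEquality using (_≡_; _≢_; refl; sym; trans; cong; cong₂; subst; subst₂)
open import Relation.Nullary using (¬_; Dec; yes; no; does; ¬?; contradiction; _×-dec_; _⊎-dec_)
open import Relation.Nullary.Decidable using (map′; dec-true; decidable-stable)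
open import Relation.Unary using (Decidable)

private variable
  A B : Set

-- Counting, pigeonhole and choice in finite lists

_∈?_ : ∀ {m} (x : Fin m) (xs : List (Fin m)) → Dec (x ∈ xs)
_∈?_ = DecMembership._∈?_ _≟_

length-filter-¬ : {P : A → Set} (P? : Decidable P) (xs : List A) →
  length (filter P? xs) + length (filter (¬? ∘ P?) xs) ≡ length xs
length-filter-¬ P? [] = refl
length-filter-¬ P? (x ∷ xs) with P? x
... | yes _ = cong suc (length-filter-¬ P? xs)
... | no _ = trans (+-suc _ _) (cong suc (length-filter-¬ P? xs))

majority : ∀ N M {P : A → Set} (P? : Decidable P) (xs : List A) → N + M ≤ length xs →
  N ≤ length (filter P? xs) ⊎ M ≤ length (filter (¬? ∘ P?) xs)
majority N M P? xs h with N ≤? length (filter P? xs)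
... | yes p = inj₁ p
... | no ¬p = inj₂ (+-cancelˡ-≤ N _ _ (≤-trans h (≤-trans (≤-reflexive (sym (length-filter-¬ P? xs)))
                 (+-monoˡ-≤ _ (<⇒≤ (≰⇒> ¬p))))))

AllPairs-resp-⊑ : {R : A → A → Set} {xs ys : List A} → xs ⊑ ys → AllPairs R ys → AllPairs R xs
AllPairs-resp-⊑ [] [] = []
AllPairs-resp-⊑ (y ∷ʳ s) (_ ∷ ps) = AllPairs-resp-⊑ s ps
AllPairs-resp-⊑ (refl ∷ s) (p ∷ ps) = All-resp-⊆ s p ∷ AllPairs-resp-⊑ s ps

pair-⊑ : {x y : A} {xs : List A} → x ∈ xs → y ∈ xs → x ≢ y →
  (x ∷ y ∷ []) ⊑ xs ⊎ (y ∷ x ∷ []) ⊑ xs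
pair-⊑ (here refl) (here refl) x≢y = contradiction refl x≢y
pair-⊑ (here refl) (there q) _ = inj₁ (refl ∷ from∈ q)
pair-⊑ (there p) (here refl) _ = inj₂ (refl ∷ from∈ p)
pair-⊑ (there p) (there q) x≢y with pair-⊑ p q x≢y
... | inj₁ s = inj₁ (_ ∷ʳ s)
... | inj₂ s = inj₂ (_ ∷ʳ s)

-- Membership is decidable, so the witnesses can be collected into a total function; `b₀` is a junk
-- value outside the list.
choice : DecidableEquality A → (b₀ : B) {R : A → B → Set} (xs : List A) →
  (∀ {x} → x ∈ xs → ∃ (R x)) → Σ (A → B) λ f → ∀ {x} → x ∈ xs → R x (f x)
choice {A = A} {B = B} _≟_ b₀ {R} xs h = f , ok
  where
    f : A → B
    f x with DecMembership._∈?_ _≟_ x xs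
    ... | yes p = proj₁ (h p)
    ... | no _ = b₀
    ok : ∀ {x} → x ∈ xs → R x (f x)
    ok {x} p with DecMembership._∈?_ _≟_ x xs
    ... | yes q = proj₂ (h q)
    ... | no ¬q = contradiction p ¬q

-- An early exit through a list: later `G` says that a long hole was found and `P` that a short
-- connection exists.
traverse : {G : Set} {P : A → Set} (xs : List A) → (∀ {x} → x ∈ xs → G ⊎ P x) →
  G ⊎ (∀ {x} → x ∈ xs → P x)
traverse [] h = inj₂ λ ()
traverse (x ∷ xs) h with h (here refl) | traverse xs (h ∘ there)
... | inj₁ g | _ = inj₁ g
... | inj₂ _ | inj₁ g = inj₁ g
... | inj₂ p | inj₂ ps = inj₂ λ { (here refl) → p ; (there q) → ps q }

length-filter-≢ : {P : A → Set} (P? : Decidable P) {xs : List A} → Unique xs →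
  (∀ {x y} → x ∈ xs → y ∈ xs → P x → P y → x ≡ y) → length xs ≤ suc (length (filter (¬? ∘ P?) xs))
length-filter-≢ P? {[]} [] h = z≤n
length-filter-≢ P? {x ∷ xs} (x∉ ∷ u) h with P? x
... | no _ = s≤s (length-filter-≢ P? u (λ p q → h (there p) (there q)))
... | yes px = s≤s (≤-reflexive (cong length (sym (filter-all (¬? ∘ P?)
      (All.tabulate λ {y} q py → All.lookup x∉ q (h (here refl) (there q) px py))))))

-- Each obstacle in `ys` hits at most one element of `xs`, so it costs at most one. Typically the
-- elements index disjoint paths and the obstacles are vertices to be avoided.
unhit : {H : A → B → Set} → (∀ x y → Dec (H x y)) → {xs : List A} → Unique xs → (ys : List B) →
  (∀ {x x' y} → x ∈ xs → x' ∈ xs → y ∈ ys → H x y → H x' y → x ≡ x') →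
  ∃ λ zs → zs ⊑ xs × length xs ≤ length zs + length ys × (∀ {x y} → x ∈ zs → y ∈ ys → ¬ H x y)
unhit H? {xs} u [] fn = xs , ⊑-refl , m≤m+n _ _ , λ _ ()
unhit H? {xs} u (y ∷ ys) fn with unhit H? u ys (λ p q → fn p q ∘ there)
... | zs , s , le , ok = filter (¬? ∘ Hy?) zs , ⊑-trans (filter-⊆ _ zs) s ,
    ≤-trans le (≤-trans (+-monoˡ-≤ (length ys) (length-filter-≢ Hy? (AllPairs-resp-⊑ s u)
        (λ p q → fn (⊑⇒∈ s p) (⊑⇒∈ s q) (here refl))))
      (≤-reflexive (sym (+-suc _ (length ys))))) ,
    λ { p (here refl) → proj₂ (∈-filter⁻ (¬? ∘ Hy?) {xs = zs} p)
      ; p (there q) → ok (proj₁ (∈-filter⁻ (¬? ∘ Hy?) {xs = zs} p)) q }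
  where Hy? = λ x → H? x y

-- Induction on `ys`: either its head is hit by `K` elements, or enough elements that miss it remain
-- for the tail.
pigeonhole : {H : A → B → Set} → (∀ x y → Dec (H x y)) → ∀ K (xs : List A) (ys : List B) →
  (∀ {x} → x ∈ xs → ∃ λ y → y ∈ ys × H x y) → suc (length ys * K) ≤ length xs →
  ∃ λ y → y ∈ ys × ∃ λ zs → zs ⊑ xs × K ≤ length zs × (∀ {x} → x ∈ zs → H x y)
pigeonhole H? K [] [] h ()
pigeonhole H? K (x ∷ xs) [] h le with h (here refl)
... | _ , () , _
pigeonhole H? K xs (y ∷ ys) h le
  with majority K (suc (length ys * K)) (λ x → H? x y) xs (≤-trans (≤-reflexive (+-suc K _)) le)
... | inj₁ p = y , here refl , filter (λ x → H? x y) xs , filter-⊆ _ xs , p ,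
      λ q → proj₂ (∈-filter⁻ (λ x → H? x y) {xs = xs} q)
... | inj₂ p with pigeonhole H? K (filter (λ x → ¬? (H? x y)) xs) ys rest p
  where
    rest : ∀ {x} → x ∈ filter (λ x → ¬? (H? x y)) xs → ∃ λ z → z ∈ ys × _
    rest q with ∈-filter⁻ (λ x → ¬? (H? x y)) {xs = xs} q
    ... | q∈ , ¬Hq with h q∈
    ... | _ , here refl , Hq = contradiction Hq ¬Hq
    ... | z , there z∈ , Hq = z , z∈ , Hq
... | z , z∈ , zs , s , K≤ , ok = z , there z∈ , zs , ⊑-trans s (filter-⊆ _ xs) , K≤ , ok

-- Let each element of `ys` remove its equal from `xs`: nothing survives, so the count in `unhit` is
-- the claim.
Unique-⊆-length : DecidableEquality A → {xs ys : List A} → Unique xs → (∀ {x} → x ∈ xs → x ∈ ys) →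
  length xs ≤ length ys
Unique-⊆-length _≟_ {[]} u sub = z≤n
Unique-⊆-length _≟_ {x ∷ xs} {ys} u sub
  with unhit (λ x y → x ≟ y) u ys (λ { _ _ _ refl refl → refl })
... | [] , _ , le , _ = le
... | z ∷ zs , s , le , ok = contradiction refl (ok (here refl) (sub (⊑⇒∈ s (here refl))))

-- Ramsey's theorem for hypergraphs

-- An `r`-subset is a vector whose list is a sublist, so colourings need not be symmetric: only
-- tuples in list order are read.
Hom : ∀ {A : Set} r → (Vec A r → Bool) → Bool → List A → Set
Hom r f b ys = ∀ zs → toList zs ⊑ ys → f zs ≡ b

Hom-⊑ : ∀ {r} {f : Vec A r → Bool} {b xs ys} → xs ⊑ ys → Hom r f b ys → Hom r f b xs
Hom-⊑ s h zs zs⊑ = h zs (⊑-trans zs⊑ s)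

-- The colour of an (r+1)-subset depends only on its first element.
data EndHom {A : Set} {r} (f : Vec A (suc r) → Bool) : List (A × Bool) → Set where
  []  : EndHom f []
  _∷_ : ∀ {x b ps} → Hom r (f ∘ (x ∷_)) b (map proj₁ ps) → EndHom f ps → EndHom f ((x , b) ∷ ps)

EndHom-⊑ : ∀ {r} {f : Vec A (suc r) → Bool} {ps qs} → qs ⊑ ps → EndHom f ps → EndHom f qs
EndHom-⊑ [] [] = []
EndHom-⊑ (_ ∷ʳ s) (_ ∷ e) = EndHom-⊑ s e
EndHom-⊑ {f = f} (refl ∷ s) (h ∷ e) = Hom-⊑ {f = f ∘ _} (map⁺ proj₁ s) h ∷ EndHom-⊑ s e

EndHom⇒Hom : ∀ {r} {f : Vec A (suc r) → Bool} {b ps} → All (λ p → proj₂ p ≡ b) ps → EndHom f ps →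
  Hom (suc r) f b (map proj₁ ps)
EndHom⇒Hom [] [] (z ∷ zs) ()
EndHom⇒Hom (_ ∷ all) (_ ∷ e) (z ∷ zs) (_ ∷ʳ s) = EndHom⇒Hom all e (z ∷ zs) s
EndHom⇒Hom (refl ∷ _) (h ∷ _) (z ∷ zs) (refl ∷ s) = h zs s

majority-colour : ∀ {r} {f : Vec A (suc r) → Bool} N {ps} → N + N ≤ length ps → EndHom f ps →
  ∃ λ qs → qs ⊑ ps × N ≤ length qs × ∃ λ b → Hom (suc r) f b (map proj₁ qs)
majority-colour {A = A} N {ps} len e with majority N N true? ps len
  where
    true? : (p : A × Bool) → Dec (proj₂ p ≡ true)
    true? p = proj₂ p ≟ᵇ true
... | inj₁ N≤ = _ , filter-⊆ _ ps , N≤ , true ,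
  EndHom⇒Hom (All.tabulate λ q → proj₂ (∈-filter⁻ _ {xs = ps} q)) (EndHom-⊑ (filter-⊆ _ ps) e)
... | inj₂ N≤ = _ , filter-⊆ _ ps , N≤ , false ,
  EndHom⇒Hom (All.tabulate λ q → ¬-not (proj₂ (∈-filter⁻ _ {xs = ps} q))) (EndHom-⊑ (filter-⊆ _ ps) e)

-- Abstract because these tower-type bounds must never be unfolded.
abstract
  ramseyBound : ℕ → ℕ → ℕ
  endBound : ℕ → ℕ → ℕ

  ramseyBound zero N = N
  ramseyBound (suc r) N = endBound r (N + N)

  endBound r zero = 0
  endBound r (suc M) = suc (ramseyBound r (endBound r M))

  -- Induction on `r`: an end-homogeneous sequence of length `N + N` has `N` elements that force the
  -- same colour as first elements.
  ramsey : ∀ r N (f : Vec A r → Bool) xs → ramseyBound r N ≤ length xs →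
    ∃ λ ys → ys ⊑ xs × N ≤ length ys × ∃ λ b → Hom r f b ys

  -- Take the first element `x`, make the rest homogeneous for the link colouring `f ∘ (x ∷_)`, and
  -- repeat inside the result.
  endHom : ∀ r M (f : Vec A (suc r) → Bool) xs → endBound r M ≤ length xs →
    ∃ λ ps → map proj₁ ps ⊑ xs × M ≤ length ps × EndHom f ps

  ramsey zero N f xs le = xs , ⊑-refl , le , f [] , λ { [] _ → refl }
  ramsey (suc r) N f xs le with endHom r (N + N) f xs le
  ... | ps , ps⊑ , len , e with majority-colour N len e
  ... | qs , qs⊑ , N≤ , b , hom = map proj₁ qs , ⊑-trans (map⁺ proj₁ qs⊑) ps⊑ ,
    ≤-trans N≤ (≤-reflexive (sym (length-map proj₁ qs))) , b , hom

  endHom r zero f xs le = [] , minimum xs , z≤n , []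
  endHom r (suc M) f (x ∷ xs) (s≤s le) with ramsey r (endBound r M) (f ∘ (x ∷_)) xs le
  ... | ys , ys⊑ , len , b , hom with endHom r M f ys len
  ... | ps , ps⊑ , M≤ , e = (x , b) ∷ ps , refl ∷ ⊑-trans ps⊑ ys⊑ , s≤s M≤ , Hom-⊑ {f = f ∘ (x ∷_)} ps⊑ hom ∷ e

  -- One application of Ramsey's theorem per forbidden pattern: the homogeneous list must be long
  -- enough to be impossible in colour `true` and to carry the remaining rounds in colour `false`.
  avoidBound : ℕ → ℕ → ℕ → ℕ → ℕ
  avoidBound r h N zero = N
  avoidBound r h N (suc k) = ramseyBound r (h ⊔ avoidBound r h N k)

  -- Each type is a pattern whose homogeneous presence is impossible, so all types can be avoided at once.
  ramseyAvoid : ∀ {Ty : Set} r h N (τs : List Ty) (f : Ty → Vec A r → Bool) xs →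
    avoidBound r h N (length τs) ≤ length xs →
    (∀ {τ ys} → τ ∈ τs → ys ⊑ xs → h ≤ length ys → ¬ Hom r (f τ) true ys) →
    ∃ λ ys → ys ⊑ xs × N ≤ length ys × (∀ {τ} → τ ∈ τs → Hom r (f τ) false ys)
  ramseyAvoid r h N [] f xs le bad = xs , ⊑-refl , le , λ ()
  ramseyAvoid r h N (τ ∷ τs) f xs le bad with ramsey r (h ⊔ avoidBound r h N (length τs)) (f τ) xs le
  ... | ys , ys⊑ , len , true , hom = contradiction hom (bad (here refl) ys⊑ (≤-trans (m≤m⊔n h _) len))
  ... | ys , ys⊑ , len , false , hom
    with ramseyAvoid r h N τs f ys (≤-trans (m≤n⊔m h _) len) (λ τ∈ s → bad (there τ∈) (⊑-trans s ys⊑))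
  ... | zs , zs⊑ , N≤ , ok = zs , ⊑-trans zs⊑ ys⊑ , N≤ ,
        λ { (here refl) → Hom-⊑ {f = f τ} zs⊑ hom ; (there q) → ok q }

-- One element from each of `r` consecutive segments gives a tuple in list order, whatever the
-- choices. Hence the coordinates of a homogeneous tuple can be varied independently.
record Blocks (A : Set) (r N : ℕ) (ys : List A) : Set where
  field
    block     : Fin r → List A
    block-len : ∀ c → N ≤ length (block c)
    block-⊑   : ∀ c → block c ⊑ ys
    transversal : ∀ (zs : Vec A r) → (∀ c → Vec.lookup zs c ∈ block c) → toList zs ⊑ ys

blocks : ∀ r N (ys : List A) → r * N ≤ length ys → Blocks A r N ys
blocks zero N ys le = record
  { block = λ () ; block-len = λ () ; block-⊑ = λ () ; transversal = λ { [] _ → minimum ys } }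
blocks (suc r) N ys le = record
  { block = λ { zero → take N ys ; (suc c) → block c }
  ; block-len = λ { zero → ≤-trans (⊓-glb ≤-refl (≤-trans (m≤m+n N _) le)) (≤-reflexive (sym (length-take N ys)))
                  ; (suc c) → block-len c }
  ; block-⊑ = λ { zero → take-⊆ N ys ; (suc c) → ⊑-trans (block-⊑ c) (drop-⊆ N ys) }
  ; transversal = λ { (z ∷ zs) h → subst (z ∷ toList zs ⊑_) (take++drop≡id N ys)
      (++⁺ (from∈ (h zero)) (transversal zs (h ∘ suc))) } }
  where
    open Blocks (blocks r N (drop N ys)
      (≤-trans (m+n≤o⇒m≤o∸n (r * N) (≤-trans (≤-reflexive (+-comm (r * N) N)) le)) (≤-reflexive (sym (length-drop N ys)))))

whole : (ys : List A) → ∃ λ (zs : Vec A (length ys)) → toList zs ≡ ys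
whole ys = Vec.fromList ys , toList∘fromList ys

-- Homogeneity speaks only of full `r`-tuples in list order; this brings smaller sets under its
-- scope. The head of `ys` is kept if it occurs in `us` and skipped as long as `r` elements remain;
-- when exactly `r` are left, all are taken.
cover : DecidableEquality A → ∀ r (ys us : List A) → All (_∈ ys) us → length us ≤ r → r ≤ length ys →
  ∃ λ (zs : Vec A r) → toList zs ⊑ ys × All (_∈ toList zs) us
cover _≟_ .0 [] us all le z≤n = [] , [] , all
cover _≟_ r (y ∷ ys) us all le le' with Any.any? (λ u → u ≟ y) us
cover _≟_ zero (y ∷ ys) (_ ∷ _) all () le' | yes _
cover _≟_ (suc r) (y ∷ ys) us all le (s≤s le') | yes p
  with cover _≟_ r ys (filter (λ u → ¬? (u ≟ y)) us) rest (s≤s⁻¹ (≤-trans (removed us p) le)) le'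
  where
    rest : All (_∈ ys) (filter (λ u → ¬? (u ≟ y)) us)
    rest = All.tabulate λ q → let (q∈ , q≢) = ∈-filter⁻ (λ u → ¬? (u ≟ y)) {xs = us} q in
      tail-∈ (All.lookup all q∈) q≢
      where
        tail-∈ : ∀ {u} → u ∈ (y ∷ ys) → u ≢ y → u ∈ ys
        tail-∈ (here e) n = contradiction e n
        tail-∈ (there q) _ = q
    removed : ∀ us → Any (_≡ y) us → length (filter (λ u → ¬? (u ≟ y)) us) < length us
    removed (u ∷ us) p with u ≟ y
    removed (u ∷ us) p | yes _ = s≤s (length-filter (λ u → ¬? (u ≟ y)) us)
    removed (u ∷ us) (here e) | no n = contradiction e n
    removed (u ∷ us) (there p) | no _ = s≤s (removed us p)
... | zs , s , ok = y ∷ zs , refl ∷ s , All.tabulate member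
  where
    member : ∀ {u} → u ∈ us → u ∈ (y ∷ toList zs)
    member {u} q with u ≟ y
    ... | yes e = here e
    ... | no n = there (All.lookup ok (∈-filter⁺ (λ u → ¬? (u ≟ y)) q n))
cover _≟_ r (y ∷ ys) us all le le' | no ¬p with r ≤? length ys
... | yes r≤ with cover _≟_ r ys us (All.tabulate λ q → tail-∈ q (All.lookup all q)) le r≤
  where
    tail-∈ : ∀ {u} → u ∈ us → u ∈ (y ∷ ys) → u ∈ ys
    tail-∈ q (here refl) = contradiction (lose q refl) ¬p
    tail-∈ _ (there q) = q
...   | zs , s , ok = zs , y ∷ʳ s , ok
cover _≟_ r (y ∷ ys) us all le le' | no ¬p | no r≰ with ≤-antisym le' (≰⇒> r≰)
... | refl with whole (y ∷ ys)
... | zs , eq = zs , subst (_⊑ (y ∷ ys)) (sym eq) ⊑-refl , subst (λ l → All (_∈ l) us) (sym eq) all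

index-toList : ∀ {r} {zs : Vec A r} {x} → x ∈ toList zs → ∃ λ p → Vec.lookup zs p ≡ x
index-toList {zs = _ ∷ _} (here refl) = zero , refl
index-toList {zs = _ ∷ zs} (there q) with index-toList {zs = zs} q
... | p , e = suc p , e

select : ∀ m {xs : List A} → Unique xs → m ≤ length xs →
  Σ (Fin m → A) λ e → (∀ i → e i ∈ xs) × (∀ i j → e i ≡ e j → i ≡ j)
select zero u le = (λ ()) , (λ ()) , λ ()
select {A = A} (suc m) {x ∷ xs} (x∉ ∷ u) (s≤s le) with select m u le
... | e , e∈ , inj = e' , e'∈ , e'-inj
  where
    e' : Fin (suc m) → A
    e' zero = x
    e' (suc i) = e i
    e'∈ : ∀ i → e' i ∈ (x ∷ xs)
    e'∈ zero = here refl
    e'∈ (suc i) = there (e∈ i)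
    e'-inj : ∀ i j → e' i ≡ e' j → i ≡ j
    e'-inj zero zero _ = refl
    e'-inj zero (suc j) q = contradiction q (All.lookup x∉ (e∈ j))
    e'-inj (suc i) zero q = contradiction (sym q) (All.lookup x∉ (e∈ i))
    e'-inj (suc i) (suc j) q = cong suc (inj i j q)

lookup-∈ : ∀ {r} (zs : Vec A r) p → Vec.lookup zs p ∈ toList zs
lookup-∈ (z ∷ zs) zero = here refl
lookup-∈ (z ∷ zs) (suc p) = there (lookup-∈ zs p)

lookup-injective : ∀ {r} (zs : Vec A r) → Unique (toList zs) → ∀ i j →
  Vec.lookup zs i ≡ Vec.lookup zs j → i ≡ j
lookup-injective (z ∷ zs) _ zero zero _ = refl
lookup-injective (z ∷ zs) (z∉ ∷ _) zero (suc j) e = contradiction e (All.lookup z∉ (lookup-∈ zs j))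
lookup-injective (z ∷ zs) (z∉ ∷ _) (suc i) zero e = contradiction (sym e) (All.lookup z∉ (lookup-∈ zs i))
lookup-injective (z ∷ zs) (_ ∷ u) (suc i) (suc j) e = cong suc (lookup-injective zs u i j e)

InjOn : (A → B) → List A → Set
InjOn f xs = ∀ {x y} → x ∈ xs → y ∈ xs → f x ≡ f y → x ≡ y

-- Walks and induced paths

module Walks (G : Graph) where

  Vx : Set
  Vx = Fin (n G)

  Adj? : ∀ u v → Dec (Adj G u v)
  Adj? u v = T? (adj G u v)

  Adj-sym : ∀ {u v} → Adj G u v → Adj G v u
  Adj-sym {u} {v} = subst T (Graph.sym G u v)

  Adj-irrefl : ∀ {u v} → Adj G u v → u ≢ v
  Adj-irrefl {u} a refl = subst T (irrefl G u) a

  -- The list of a walk omits its first vertex, so its length is that of the walk.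
  data Walk : Vx → List Vx → Vx → Set where
    []  : ∀ {u} → Walk u [] u
    _∷_ : ∀ {u w ps v} → Adj G u w → Walk w ps v → Walk u (w ∷ ps) v

  data Ind : Vx → List Vx → Vx → Set where
    []  : ∀ {u} → Ind u [] u
    ext : ∀ {u w ps v} → Adj G u w → All (λ z → ¬ (Adj G u z ⊎ u ≡ z)) ps → Ind w ps v →
            Ind u (w ∷ ps) v

  Ind⇒Walk : ∀ {u ps v} → Ind u ps v → Walk u ps v
  Ind⇒Walk [] = []
  Ind⇒Walk (ext a _ p) = a ∷ Ind⇒Walk p

  end-∈ : ∀ {u ps v} → Walk u ps v → v ∈ (u ∷ ps)
  end-∈ [] = here refl
  end-∈ (_ ∷ w) = there (end-∈ w)

  _+++_ : ∀ {u ps v qs w} → Walk u ps v → Walk v qs w → Walk u (ps ++ qs) w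
  [] +++ w' = w'
  (a ∷ w) +++ w' = a ∷ (w +++ w')

  reverseWalk : ∀ {u ps v} → Walk u ps v →
    ∃ λ qs → Walk v qs u × length qs ≡ length ps × (∀ {z} → z ∈ qs → z ∈ (u ∷ ps))
  reverseWalk [] = [] , [] , refl , λ ()
  reverseWalk {u} {w ∷ ps} {v} (a ∷ p) with reverseWalk p
  ... | qs , q , len , sub = qs ++ u ∷ [] , q +++ (Adj-sym a ∷ []) ,
    trans (length-++ qs) (trans (+-comm (length qs) 1) (cong suc len)) ,
    λ z∈ → [ there ∘ sub , (λ { (here refl) → here refl }) ]′ (∈-++⁻ qs z∈)

  -- Join u to the last vertex of the path that equals u or is adjacent to it.
  attach : ∀ u {w qs v} → Ind w qs v → Any (λ z → Adj G u z ⊎ u ≡ z) (w ∷ qs) →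
    ∃ λ qs' → Ind u qs' v × length qs' ≤ suc (length qs) × (∀ {z} → z ∈ qs' → z ∈ (w ∷ qs))
  attach u {w} {qs} p h with Any.any? (λ z → Adj? u z ⊎-dec (u ≟ z)) qs
  attach u {w} {_ ∷ _} (ext _ _ p) h | yes h' with attach u p h'
  ... | qs' , p' , len , sub = qs' , p' , ≤-trans len (n≤1+n _) , there ∘ sub
  attach u p (there h) | no ¬h = contradiction h ¬h
  attach u {w} {qs} p (here (inj₁ a)) | no ¬h = w ∷ qs , ext a (AllP.¬Any⇒All¬ qs ¬h) p , ≤-refl , λ z → z
  attach u {w} {qs} p (here (inj₂ refl)) | no ¬h = qs , p , n≤1+n _ , there

  -- Built from the end of the walk backwards: `attach` joins each vertex to its last contact with
  -- the induced path found so far, which bypasses all chords.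
  shortcut : ∀ {u ps v} → Walk u ps v →
    ∃ λ qs → Ind u qs v × length qs ≤ length ps × (∀ {z} → z ∈ qs → z ∈ ps)
  shortcut [] = [] , [] , z≤n , λ z → z
  shortcut (a ∷ w) with shortcut w
  ... | qs , p , len , sub with attach _ p (here (inj₁ a))
  ... | qs' , p' , len' , sub' = qs' , p' , ≤-trans len' (s≤s len) ,
        λ z → [ (λ { refl → here refl }) , there ∘ sub ]′ (uncons (sub' z))
    where
      uncons : ∀ {x z : Vx} {xs} → z ∈ (x ∷ xs) → z ≡ x ⊎ z ∈ xs
      uncons (here e) = inj₁ e
      uncons (there q) = inj₂ q

  -- nth u ps i is the entry of u ∷ ps at position i, with a junk value beyond the end.
  nth : Vx → List Vx → ℕ → Vx
  nth u ps zero = u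
  nth u [] (suc i) = u
  nth u (w ∷ ps) (suc i) = nth w ps i

  nth-∈ : ∀ u ps i → nth u ps i ∈ (u ∷ ps)
  nth-∈ u ps zero = here refl
  nth-∈ u [] (suc i) = here refl
  nth-∈ u (w ∷ ps) (suc i) = there (nth-∈ w ps i)

  nth-∈-tail : ∀ u ps {i} → i < length ps → nth u ps (suc i) ∈ ps
  nth-∈-tail u (w ∷ ps) {i} _ = nth-∈ w ps i

  nth-end : ∀ {u ps v} → Walk u ps v → nth u ps (length ps) ≡ v
  nth-end [] = refl
  nth-end (_ ∷ w) = nth-end w

  prefix : ∀ {u ps v} → Walk u ps v → ∀ i → i ≤ length ps → Walk u (take i ps) (nth u ps i)
  prefix w zero le = []
  prefix (a ∷ w) (suc i) (s≤s le) = a ∷ prefix w i le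

  Near : ℕ → ℕ → Set
  Near i j = (suc i ≡ j) ⊎ (suc j ≡ i)

  Near-pred : ∀ {i j} → Near (suc i) (suc j) → Near i j
  Near-pred (inj₁ e) = inj₁ (suc-injective e)
  Near-pred (inj₂ e) = inj₂ (suc-injective e)

  Near-suc : ∀ {i j} → Near i j → Near (suc i) (suc j)
  Near-suc (inj₁ e) = inj₁ (cong suc e)
  Near-suc (inj₂ e) = inj₂ (cong suc e)

  private
    far : ∀ {u ps} → All (λ z → ¬ (Adj G u z ⊎ u ≡ z)) ps → ∀ {z} → z ∈ ps → ¬ (Adj G u z ⊎ u ≡ z)
    far = All.lookup

  Ind-inj : ∀ {u ps v} → Ind u ps v → ∀ {i j} → i ≤ length ps → j ≤ length ps →
    nth u ps i ≡ nth u ps j → i ≡ j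
  Ind-inj p {zero} {zero} _ _ _ = refl
  Ind-inj (ext a f p) {zero} {suc zero} _ _ e = contradiction e (Adj-irrefl a)
  Ind-inj (ext a f p) {zero} {suc (suc j)} _ (s≤s j<) e = contradiction (inj₂ e) (far f (nth-∈-tail _ _ j<))
  Ind-inj (ext a f p) {suc zero} {zero} _ _ e = contradiction (sym e) (Adj-irrefl a)
  Ind-inj (ext a f p) {suc (suc i)} {zero} (s≤s i<) _ e = contradiction (inj₂ (sym e)) (far f (nth-∈-tail _ _ i<))
  Ind-inj (ext a f p) {suc i} {suc j} (s≤s le) (s≤s le') e = cong suc (Ind-inj p le le' e)

  Ind-near : ∀ {u ps v} → Ind u ps v → ∀ {i j} → i ≤ length ps → j ≤ length ps →
    Adj G (nth u ps i) (nth u ps j) → Near i j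
  Ind-near p {zero} {zero} _ _ a = contradiction refl (Adj-irrefl a)
  Ind-near (ext _ _ _) {zero} {suc zero} _ _ _ = inj₁ refl
  Ind-near (ext _ f p) {zero} {suc (suc j)} _ (s≤s j<) a = contradiction (inj₁ a) (far f (nth-∈-tail _ _ j<))
  Ind-near (ext _ _ _) {suc zero} {zero} _ _ _ = inj₂ refl
  Ind-near (ext _ f p) {suc (suc i)} {zero} (s≤s i<) _ a = contradiction (inj₁ (Adj-sym a)) (far f (nth-∈-tail _ _ i<))
  Ind-near (ext _ _ p) {suc i} {suc j} (s≤s le) (s≤s le') a with Ind-near p le le' a
  ... | inj₁ e = inj₁ (cong suc e)
  ... | inj₂ e = inj₂ (cong suc e)

  Walk-adj : ∀ {u ps v} → Walk u ps v → ∀ {i} → i < length ps → Adj G (nth u ps i) (nth u ps (suc i))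
  Walk-adj (a ∷ w) {zero} _ = a
  Walk-adj (a ∷ w) {suc i} (s≤s le) = Walk-adj w le

  Ind-adjIff : ∀ {u ps v} → Ind u ps v → ∀ {i j} → i ≤ length ps → j ≤ length ps →
    Adj G (nth u ps i) (nth u ps j) ⇔ Near i j
  Ind-adjIff p le le' = mk⇔ (Ind-near p le le')
    λ { (inj₁ refl) → Walk-adj (Ind⇒Walk p) le' ; (inj₂ refl) → Adj-sym (Walk-adj (Ind⇒Walk p) le) }

  private
    tabulate-Ind : ∀ l (vx : Fin (suc l) → Vx) → (∀ i j → vx i ≡ vx j → i ≡ j) →
      (∀ i j → Adj G (vx i) (vx j) ⇔ Near (toℕ i) (toℕ j)) →
      Ind (vx zero) (tabulate (vx ∘ suc)) (vx (fromℕ l))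
    tabulate-Ind zero vx inj iff = []
    tabulate-Ind (suc l) vx inj iff =
      ext (Equivalence.from (iff zero (suc zero)) (inj₁ refl))
      (AllP.tabulate⁺ (λ i → λ { (inj₁ a) → absurd (Equivalence.to (iff zero (suc (suc i))) a)
                              ; (inj₂ e) → absurd' (inj zero (suc (suc i)) e) }))
      (tabulate-Ind l (vx ∘ suc) (λ i j e → Fin-suc-injective (inj (suc i) (suc j) e))
        (λ i j → mk⇔ (Near-pred ∘ Equivalence.to (iff (suc i) (suc j)))
                     (Equivalence.from (iff (suc i) (suc j)) ∘ Near-suc)))
      where
        absurd : ∀ {k} → Near 0 (suc (suc k)) → ⊥
        absurd (inj₁ ())
        absurd (inj₂ ())
        absurd' : ∀ {k} {i : Fin k} → zero ≡ Fin.suc i → ⊥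
        absurd' ()

  vertices : ∀ {U x y} → IPath G U x y → List Vx
  vertices P = tabulate (vx P ∘ suc)

  IPath⇒Ind : ∀ {U x y} (P : IPath G U x y) → Ind x (vertices P) y
  IPath⇒Ind P with tabulate-Ind (len P) (vx P) (IPath.inj P) (IPath.adjIff P)
  ... | p rewrite start P | end P = p

  length-vertices : ∀ {U x y} (P : IPath G U x y) → length (vertices P) ≡ len P
  length-vertices P = length-tabulate (vx P ∘ suc)

  ∈⇒OnPath : ∀ {U x y} (P : IPath G U x y) {v} → v ∈ (x ∷ vertices P) → OnPath v P
  ∈⇒OnPath P (here refl) = zero , start P
  ∈⇒OnPath P (there q) with ∈-tabulate⁻ q
  ... | i , e = suc i , sym e

  ∈⇒inU : ∀ {U x y} (P : IPath G U x y) {v} → v ∈ (x ∷ vertices P) → v Sub.∈ U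
  ∈⇒inU P q with ∈⇒OnPath P q
  ... | i , refl = inU P i

  -- `X` is demanded only after the first vertex, so reversing a walk needs `X u`. The cases used
  -- are membership in `U` and avoidance of a finite list.
  ShortWalk : ℕ → (Vx → Set) → Vx → Vx → Set
  ShortWalk d X u v = ∃ λ ps → Walk u ps v × length ps ≤ d × (∀ {z} → z ∈ ps → X z)

  -- A search over first steps. It makes the case distinction between linked and separable pairs
  -- constructive.
  shortWalk? : ∀ d {X : Vx → Set} → Decidable X → ∀ u v → Dec (ShortWalk d X u v)
  shortWalk? zero X? u v with u ≟ v
  ... | yes refl = yes ([] , [] , z≤n , λ ())
  ... | no n = no λ { ([] , [] , _) → n refl ; (_ ∷ _ , _ , () , _) }
  shortWalk? (suc d) {X} X? u v with u ≟ v
  ... | yes refl = yes ([] , [] , z≤n , λ ())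
  ... | no n = map′ into out (any? λ w → Adj? u w ×-dec (X? w ×-dec shortWalk? d X? w v))
    where
      into : (∃ λ w → Adj G u w × X w × ShortWalk d X w v) → ShortWalk (suc d) X u v
      into (w , a , xw , ps , p , le , ok) =
        w ∷ ps , a ∷ p , s≤s le , λ { (here refl) → xw ; (there q) → ok q }
      out : ShortWalk (suc d) X u v → ∃ λ w → Adj G u w × X w × ShortWalk d X w v
      out ([] , [] , _) = contradiction refl n
      out (w ∷ ps , a ∷ p , s≤s le , ok) = w , a , ok (here refl) , ps , p , le , λ q → ok (there q)

  ShortWalk-sym : ∀ {d X u v} → X u → ShortWalk d X u v → ShortWalk d X v u
  ShortWalk-sym {X = X} Xu (ps , w , le , ok) with reverseWalk w
  ... | qs , w' , eq , sub = qs , w' , ≤-trans (≤-reflexive eq) le , λ q → ok' (sub q)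
    where
      ok' : ∀ {z} → z ∈ _ → X z
      ok' (here refl) = Xu
      ok' (there q) = ok q

  ShortWalk-trans : ∀ {d e X u v w} → ShortWalk d X u v → ShortWalk e X v w → ShortWalk (d + e) X u w
  ShortWalk-trans (ps , p , le , ok) (qs , q , le' , ok') = ps ++ qs , p +++ q ,
    ≤-trans (≤-reflexive (length-++ ps)) (+-mono-≤ le le') , λ z∈ → [ ok , ok' ]′ (∈-++⁻ ps z∈)

  ShortWalk-edge : ∀ {X : Vx → Set} {u v} → Adj G u v → X v → ShortWalk 1 X u v
  ShortWalk-edge a Xv = _ ∷ [] , a ∷ [] , ≤-refl , λ { (here refl) → Xv }

  ShortWalk-≤ : ∀ {d e X u v} → d ≤ e → ShortWalk d X u v → ShortWalk e X u v
  ShortWalk-≤ le (ps , p , le' , ok) = ps , p , ≤-trans le' le , ok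

-- Robustly linked sets

onPair : (A → A → Bool) → Vec A 2 → Bool
onPair f (a ∷ b ∷ []) = f a b

-- Among this many vertices `t` are pairwise non-adjacent, since cliques of size `t` are excluded.
biBound : ℕ → ℕ
biBound t = avoidBound 2 t t 1

module Bicliques (G : Graph) (t : ℕ) (clean : Clean t G) where
  open Walks G

  clique-free : {X : A → Vx} {xs : List A} → Unique xs → InjOn X xs → t ≤ length xs →
    ¬ Hom 2 (onPair λ a b → adj G (X a) (X b)) true xs
  clique-free {A = A} {X = X} {xs} u inj le hom = proj₁ clean (record
    { emb = X ∘ e
    ; inj = λ i j eq → e-inj i j (inj (e∈ i) (e∈ j) eq)
    ; inU = λ _ → ∈⊤
    ; adjIff = λ i j → mk⇔ (λ i≢j → adjacent (e∈ i) (e∈ j) (i≢j ∘ e-inj i j)) (λ { a refl → Adj-irrefl a refl })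
    })
    where
      sel = select t u le
      e = proj₁ sel
      e∈ = proj₁ (proj₂ sel)
      e-inj = proj₂ (proj₂ sel)
      adjacent : ∀ {a b} → a ∈ xs → b ∈ xs → a ≢ b → Adj G (X a) (X b)
      adjacent p q a≢b with pair-⊑ p q a≢b
      ... | inj₁ s = Equivalence.from T-≡ (hom _ s)
      ... | inj₂ s = Adj-sym (Equivalence.from T-≡ (hom _ s))

  false⇒¬T : ∀ {b} → b ≡ false → ¬ T b
  false⇒¬T refl ()

  stable-subset : ∀ N {X : A → Vx} {xs : List A} → Unique xs → InjOn X xs → avoidBound 2 t N 1 ≤ length xs →
    ∃ λ ys → ys ⊑ xs × N ≤ length ys × (∀ {a b} → a ∈ ys → b ∈ ys → ¬ Adj G (X a) (X b))
  stable-subset N {X} {xs} u inj le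
    with ramseyAvoid 2 t N (tt ∷ []) (λ _ → onPair λ a b → adj G (X a) (X b)) xs le
      (λ _ s l → clique-free (AllPairs-resp-⊑ s u) (λ p q → inj (⊑⇒∈ s p) (⊑⇒∈ s q)) l)
  ... | ys , s , N≤ , hom = ys , s , N≤ , apart
    where
      apart : ∀ {a b} → a ∈ ys → b ∈ ys → ¬ Adj G (X a) (X b)
      apart p q ab with pair-⊑ p q (λ { refl → Adj-irrefl ab refl })
      ... | inj₁ s' = false⇒¬T (hom (here refl) _ s') ab
      ... | inj₂ s' = false⇒¬T (hom (here refl) _ s') (Adj-sym ab)

  -- Cleanness excludes only induced bicliques, so both sides are first thinned to stable sets; they
  -- are disjoint because adjacent vertices differ.
  biclique-free : {X : A → Vx} {Y : B → Vx} {xs : List A} {ys : List B} →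
    Unique xs → Unique ys → InjOn X xs → InjOn Y ys → biBound t ≤ length xs → biBound t ≤ length ys →
    ¬ (∀ {a b} → a ∈ xs → b ∈ ys → Adj G (X a) (Y b))
  biclique-free {X = X} {Y} ux uy ix iy lx ly cross
    with stable-subset t ux ix lx | stable-subset t uy iy ly
  ... | xs' , sx , lx' , ax | ys' , sy , ly' , ay
    with select t (AllPairs-resp-⊑ sx ux) lx' | select t (AllPairs-resp-⊑ sy uy) ly'
  ... | e , e∈ , e-inj | f , f∈ , f-inj = proj₁ (proj₂ clean) (record
    { emb = [ X ∘ e , Y ∘ f ]′
    ; inj = λ { (inj₁ i) (inj₁ j) q → cong inj₁ (e-inj i j (ix (⊑⇒∈ sx (e∈ i)) (⊑⇒∈ sx (e∈ j)) q))
              ; (inj₁ i) (inj₂ j) q → contradiction q (Adj-irrefl (XY i j))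
              ; (inj₂ i) (inj₁ j) q → contradiction (sym q) (Adj-irrefl (XY j i))
              ; (inj₂ i) (inj₂ j) q → cong inj₂ (f-inj i j (iy (⊑⇒∈ sy (f∈ i)) (⊑⇒∈ sy (f∈ j)) q)) }
    ; inU = λ _ → ∈⊤
    ; adjIff = λ { (inj₁ i) (inj₁ j) → mk⇔ (λ ()) (ax (e∈ i) (e∈ j))
                 ; (inj₁ i) (inj₂ j) → mk⇔ (λ _ → XY i j) _
                 ; (inj₂ i) (inj₁ j) → mk⇔ (λ _ → Adj-sym (XY j i)) _
                 ; (inj₂ i) (inj₂ j) → mk⇔ (λ ()) (ay (f∈ i) (f∈ j)) }
    })
    where
      XY : ∀ i j → Adj G (X (e i)) (Y (f j))
      XY i j = cross (⊑⇒∈ sx (e∈ i)) (⊑⇒∈ sy (f∈ j))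

-- Terms and types for subdivided complete graphs

at : {A : Set} → List A → ℕ → Maybe A
at [] _ = nothing
at (x ∷ xs) zero = just x
at (x ∷ xs) (suc i) = at xs i

at-∈ : {A : Set} (xs : List A) (i : ℕ) {z : A} → at xs i ≡ just z → z ∈ xs
at-∈ (x ∷ xs) zero refl = here refl
at-∈ (x ∷ xs) (suc i) e = there (at-∈ xs i e)

at-lookup : {A : Set} (xs : List A) (i : Fin (length xs)) → at xs (toℕ i) ≡ just (lookup xs i)
at-lookup (x ∷ xs) zero = refl
at-lookup (x ∷ xs) (suc i) = at-lookup xs i

-- A vertex of a subdivided complete graph: a branch vertex, or the a-th inner vertex of a route.
data Term (C : Set) : Set where
  vert  : C → Term C
  inner : C → C → ℕ → Term C

mapT : {C D : Set} → (C → D) → Term C → Term D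
mapT f (vert c) = vert (f c)
mapT f (inner c c' a) = inner (f c) (f c') a

supp : {C : Set} → Term C → List C
supp (vert c) = c ∷ []
supp (inner c c' a) = c ∷ c' ∷ []

WF : {C : Set} → ℕ → Term C → Set
WF d (vert c) = Unit
WF d (inner c c' a) = c ≢ c' × a < d

length-supp : {C : Set} (T : Term C) → length (supp T) ≤ 2
length-supp (vert _) = s≤s z≤n
length-supp (inner _ _ _) = s≤s (s≤s z≤n)

mapT-cong : {C D : Set} {f g : C → D} (T : Term C) → (∀ {c} → c ∈ supp T → f c ≡ g c) → mapT f T ≡ mapT g T
mapT-cong (vert c) h = cong vert (h (here refl))
mapT-cong (inner c c' a) h = cong₂ (λ x y → inner x y a) (h (here refl)) (h (there (here refl)))

∈-supp-map : {C D : Set} {f : C → D} (T : Term C) {c : C} → c ∈ supp T → f c ∈ supp (mapT f T)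
∈-supp-map (vert _) (here refl) = here refl
∈-supp-map (inner _ _ _) (here refl) = here refl
∈-supp-map (inner _ _ _) (there (here refl)) = there (here refl)

WF-map : {C D : Set} {f : C → D} {d : ℕ} (T : Term C) → (∀ {c c'} → f c ≡ f c' → c ≡ c') →
  WF d T → WF d (mapT f T)
WF-map (vert _) _ _ = tt
WF-map (inner _ _ _) inj (n , le) = n ∘ inj , le

-- A type asks for an edge between two terms; the last two coordinates witness
-- that neither support contains the other.
Type : Set
Type = (Term (Fin 4) × Term (Fin 4)) × (Fin 4 × Fin 4)

WF? : ∀ d (T : Term (Fin 4)) → Dec (WF d T)
WF? d (vert _) = yes tt
WF? d (inner c c' a) = ¬? (c ≟ c') ×-dec (suc a ≤? d)

Valid : ℕ → Type → Set
Valid d ((T₁ , T₂) , (p , q)) = (WF d T₁ × WF d T₂) × (p ∈ supp T₁ × p ∉ supp T₂) × (q ∈ supp T₂ × q ∉ supp T₁)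

valid? : ∀ d τ → Dec (Valid d τ)
valid? d ((T₁ , T₂) , (p , q)) = (WF? d T₁ ×-dec WF? d T₂) ×-dec
  ((p ∈? supp T₁ ×-dec ¬? (p ∈? supp T₂)) ×-dec (q ∈? supp T₂ ×-dec ¬? (q ∈? supp T₁)))

innerOf : {C : Set} → C × C → ℕ → Term C
innerOf (c , c') a = inner c c' a

terms : ℕ → List (Term (Fin 4))
terms d = map vert (allFin 4) ++
  cartesianProductWith innerOf (cartesianProduct (allFin 4) (allFin 4)) (upTo d)

terms-complete : ∀ {d} (T : Term (Fin 4)) → WF d T → T ∈ terms d
terms-complete (vert c) _ = ∈-++⁺ˡ (∈-map⁺ vert (∈-allFin c))
terms-complete (inner c c' a) (_ , le) = ∈-++⁺ʳ (map vert (allFin 4))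
  (∈-cartesianProductWith⁺ innerOf (∈-cartesianProduct⁺ (∈-allFin c) (∈-allFin c')) (∈-upTo⁺ le))

abstract
  types : ℕ → List Type
  types d = filter (valid? d) (cartesianProduct (cartesianProduct (terms d) (terms d))
                                                (cartesianProduct (allFin 4) (allFin 4)))

  types-complete : ∀ {d} τ → Valid d τ → τ ∈ types d
  types-complete {d} ((T₁ , T₂) , (p , q)) v@((w₁ , w₂) , _) = ∈-filter⁺ (valid? d)
    (∈-cartesianProduct⁺ (∈-cartesianProduct⁺ (terms-complete T₁ w₁) (terms-complete T₂ w₂))
                         (∈-cartesianProduct⁺ (∈-allFin p) (∈-allFin q))) v

  types-valid : ∀ {d τ} → τ ∈ types d → Valid d τ
  types-valid {d} τ∈ = proj₂ (∈-filter⁻ (valid? d) {xs = cartesianProduct (cartesianProduct (terms d) (terms d))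
                                                (cartesianProduct (allFin 4) (allFin 4))} τ∈)

module Subdivision (G : Graph) (t : ℕ) (clean : Clean t G) (d : ℕ) where
  open Walks G
  open Bicliques G t clean

  -- `P u v` lists the inner vertices only. Ordered pairs are routed, so the routes for `(u , v)`
  -- and `(v , u)` are disjoint as well.
  record Routes (W : List Vx) (P : Vx → Vx → List Vx) : Set where
    field
      route : ∀ {u v} → u ∈ W → v ∈ W → u ≢ v → Ind u (P u v ++ v ∷ []) v
      short : ∀ {u v} → u ∈ W → v ∈ W → u ≢ v → length (P u v) ≤ d
      off   : ∀ {u v z} → u ∈ W → v ∈ W → u ≢ v → z ∈ P u v → z ∉ W
      disj  : ∀ {u v u' v' z} → u ∈ W → v ∈ W → u ≢ v → u' ∈ W → v' ∈ W → u' ≢ v' →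
              z ∈ P u v → z ∈ P u' v' → u ≡ u' × v ≡ v'

  -- A position beyond the end of a route is adjacent to nothing, so routes of different lengths can
  -- be coloured by the same types.
  adjM : Maybe Vx → Maybe Vx → Bool
  adjM (just u) (just v) = adj G u v
  adjM _ _ = false

  adjM-just : ∀ {x y} → adjM x y ≡ true → ∃₂ λ u v → x ≡ just u × y ≡ just v × Adj G u v
  adjM-just {just u} {just v} e = u , v , refl , refl , Equivalence.from T-≡ e

  module _ {W : List Vx} {P : Vx → Vx → List Vx} (uniq : Unique W) (routes : Routes W P) where
    open Routes routes

    ev : Term Vx → Maybe Vx
    ev (vert u) = just u
    ev (inner u v a) = at (P u v) a

    -- An inner vertex determines its route by `disj`, so a term can take the same value at `f` and
    -- `g` only if they agree on its indices.
    ev-supp : ∀ T {z} {f g : Fin 4 → Vx} → (∀ {c} → c ∈ supp T → f c ∈ W) → (∀ {c} → c ∈ supp T → g c ∈ W) →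
      WF d (mapT f T) → WF d (mapT g T) → ev (mapT f T) ≡ just z → ev (mapT g T) ≡ just z →
      ∀ {c} → c ∈ supp T → f c ≡ g c
    ev-supp (vert p) _ _ _ _ e e' (here refl) = just-injective (trans e (sym e'))
    ev-supp (inner p q a) {f = f} {g} fW gW (n , _) (n' , _) e e' c∈
      with disj (fW (here refl)) (fW (there (here refl))) n (gW (here refl)) (gW (there (here refl))) n'
             (at-∈ (P (f p) (f q)) a e) (at-∈ (P (g p) (g q)) a e')
    ev-supp (inner p q a) _ _ _ _ _ _ (here refl) | r , _ = r
    ev-supp (inner p q a) _ _ _ _ _ _ (there (here refl)) | _ , r = r

    conflict : Type → Vec Vx 4 → Bool
    conflict ((T₁ , T₂) , _) zs = adjM (ev (mapT (Vec.lookup zs) T₁)) (ev (mapT (Vec.lookup zs) T₂))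

    -- Vary the private coordinates p and q of the two terms independently.
    no-conflict-hom : ∀ {τ ys} → Valid d τ → ys ⊑ W → Blocks Vx 4 (suc (biBound t)) ys →
      ¬ Hom 4 (conflict τ) true ys
    no-conflict-hom {(T₁ , T₂) , (p , q)} {ys} ((w₁ , w₂) , (p∈ , p∉) , (q∈ , q∉)) s bl hom =
      biclique-free {X = X} {Y = Y} (AllPairs-resp-⊑ (⊑-trans (block-⊑ p) s) uniq)
        (AllPairs-resp-⊑ (⊑-trans (block-⊑ q) s) uniq) X-inj Y-inj
        (≤-trans (n≤1+n _) (block-len p)) (≤-trans (n≤1+n _) (block-len q)) cross
      where
        open Blocks bl
        first : ∀ c → ∃ (_∈ block c)
        first c with block c | block-len c
        ... | x ∷ _ | _ = x , here refl
        base = Vec.tabulate (proj₁ ∘ first)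
        p≢q : p ≢ q
        p≢q refl = p∉ q∈
        x : Vx → Vx → Vec Vx 4
        x a b = (base [ p ]≔ a) [ q ]≔ b
        x-q : ∀ a b → Vec.lookup (x a b) q ≡ b
        x-q a b = lookup∘update q (base [ p ]≔ a) b
        x-p : ∀ a b → Vec.lookup (x a b) p ≡ a
        x-p a b = trans (lookup∘update′ p≢q (base [ p ]≔ a) b) (lookup∘update p base a)
        x-c : ∀ a b {c} → c ≢ p → c ≢ q → Vec.lookup (x a b) c ≡ proj₁ (first c)
        x-c a b {c} np nq = trans (lookup∘update′ nq (base [ p ]≔ a) b)
          (trans (lookup∘update′ np base a) (lookup∘tabulate (proj₁ ∘ first) c))
        x∈ : ∀ {a b} → a ∈ block p → b ∈ block q → ∀ c → Vec.lookup (x a b) c ∈ block c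
        x∈ {a} {b} a∈ b∈ c with c ≟ p | c ≟ q
        ... | yes refl | _ = subst (_∈ block p) (sym (x-p a b)) a∈
        ... | no _ | yes refl = subst (_∈ block q) (sym (x-q a b)) b∈
        ... | no np | no nq = subst (_∈ block c) (sym (x-c a b np nq)) (proj₂ (first c))
        x⊑ : ∀ {a b} → a ∈ block p → b ∈ block q → toList (x a b) ⊑ ys
        x⊑ a∈ b∈ = transversal _ (x∈ a∈ b∈)
        x-W : ∀ {a b} → a ∈ block p → b ∈ block q → ∀ c → Vec.lookup (x a b) c ∈ W
        x-W a∈ b∈ c = ⊑⇒∈ s (⊑⇒∈ (block-⊑ c) (x∈ a∈ b∈ c))
        x-WF : ∀ {a b} T → a ∈ block p → b ∈ block q → WF d T → WF d (mapT (Vec.lookup (x a b)) T)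
        x-WF T a∈ b∈ = WF-map T (λ {c} {c'} → lookup-injective _ (AllPairs-resp-⊑ (⊑-trans (x⊑ a∈ b∈) s) uniq) c c')
        a₀ = proj₁ (first p)
        b₀ = proj₁ (first q)
        a₀∈ = proj₂ (first p)
        b₀∈ = proj₂ (first q)
        -- `T₁` does not mention coordinate `q`, so its vertex depends on `a` alone; likewise that
        -- of `T₂` depends on `b` alone. This turns a homogeneous colour into a biclique.
        T₁-indep : ∀ a b b' → mapT (Vec.lookup (x a b)) T₁ ≡ mapT (Vec.lookup (x a b')) T₁
        T₁-indep a b b' = mapT-cong T₁ λ {c} c∈ → agree c∈
          where
            agree : ∀ {c} → c ∈ supp T₁ → Vec.lookup (x a b) c ≡ Vec.lookup (x a b') c
            agree {c} c∈ with c ≟ p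
            ... | yes refl = trans (x-p a b) (sym (x-p a b'))
            ... | no np = trans (x-c a b np (λ { refl → q∉ c∈ })) (sym (x-c a b' np (λ { refl → q∉ c∈ })))
        T₂-indep : ∀ a a' b → mapT (Vec.lookup (x a b)) T₂ ≡ mapT (Vec.lookup (x a' b)) T₂
        T₂-indep a a' b = mapT-cong T₂ λ {c} c∈ → agree c∈
          where
            agree : ∀ {c} → c ∈ supp T₂ → Vec.lookup (x a b) c ≡ Vec.lookup (x a' b) c
            agree {c} c∈ with c ≟ q
            ... | yes refl = trans (x-q a b) (sym (x-q a' b))
            ... | no nq = trans (x-c a b (λ { refl → p∉ c∈ }) nq) (sym (x-c a' b (λ { refl → p∉ c∈ }) nq))
        -- The defaults are never reached on the blocks, where `both` provides the values.
        X Y : Vx → Vx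
        X a = fromMaybe a₀ (ev (mapT (Vec.lookup (x a b₀)) T₁))
        Y b = fromMaybe b₀ (ev (mapT (Vec.lookup (x a₀ b)) T₂))
        both : ∀ {a b} → a ∈ block p → b ∈ block q →
          ∃₂ λ u v → ev (mapT (Vec.lookup (x a b)) T₁) ≡ just u × ev (mapT (Vec.lookup (x a b)) T₂) ≡ just v × Adj G u v
        both a∈ b∈ = adjM-just (hom _ (x⊑ a∈ b∈))
        X-ev : ∀ {a b u} → ev (mapT (Vec.lookup (x a b)) T₁) ≡ just u → X a ≡ u
        X-ev {a} {b} e = cong (fromMaybe a₀) (trans (cong ev (T₁-indep a b₀ b)) e)
        Y-ev : ∀ {a b u} → ev (mapT (Vec.lookup (x a b)) T₂) ≡ just u → Y b ≡ u
        Y-ev {a} {b} e = cong (fromMaybe b₀) (trans (cong ev (T₂-indep a₀ a b)) e)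
        cross : ∀ {a b} → a ∈ block p → b ∈ block q → Adj G (X a) (Y b)
        cross a∈ b∈ with both a∈ b∈
        ... | u , v , eu , ev' , uv = subst₂ (Adj G) (sym (X-ev eu)) (sym (Y-ev ev')) uv
        X-inj : InjOn X (block p)
        X-inj {a} {a'} a∈ a'∈ e with both a∈ b₀∈ | both a'∈ b₀∈
        ... | u , _ , eu , _ | u' , _ , eu' , _ =
          trans (sym (x-p a b₀)) (trans
            (ev-supp T₁ (λ {c} _ → x-W a∈ b₀∈ c) (λ {c} _ → x-W a'∈ b₀∈ c)
              (x-WF T₁ a∈ b₀∈ w₁) (x-WF T₁ a'∈ b₀∈ w₁) eu
              (trans eu' (cong just (trans (sym (X-ev eu')) (trans (sym e) (X-ev eu))))) p∈)
            (x-p a' b₀))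
        Y-inj : InjOn Y (block q)
        Y-inj {b} {b'} b∈ b'∈ e with both a₀∈ b∈ | both a₀∈ b'∈
        ... | _ , v , _ , ev₁ , _ | _ , v' , _ , ev₂ , _ =
          trans (sym (x-q a₀ b)) (trans
            (ev-supp T₂ (λ {c} _ → x-W a₀∈ b∈ c) (λ {c} _ → x-W a₀∈ b'∈ c)
              (x-WF T₂ a₀∈ b∈ w₂) (x-WF T₂ a₀∈ b'∈ w₂) ev₁
              (trans ev₂ (cong just (trans (sym (Y-ev ev₂)) (trans (sym e) (Y-ev ev₁))))) q∈)
            (x-q a₀ b'))

    lift : (L : Term Vx) (zs : Vec Vx 4) → All (_∈ toList zs) (supp L) →
      ∃ λ T → mapT (Vec.lookup zs) T ≡ L
    lift (vert u) zs (u∈ ∷ []) with index-toList u∈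
    ... | p , refl = vert p , refl
    lift (inner u v a) zs (u∈ ∷ v∈ ∷ []) with index-toList u∈ | index-toList v∈
    ... | p , refl | q , refl = inner p q a , refl

    supp-map : {C : Set} {f : C → Vx} (T : Term C) {w : Vx} → w ∈ supp (mapT f T) → ∃ λ c → c ∈ supp T × f c ≡ w
    supp-map (vert c) (here refl) = c , here refl , refl
    supp-map (inner c c' _) (here refl) = c , here refl , refl
    supp-map (inner c c' _) (there (here refl)) = c' , there (here refl) , refl

    WF-unmap : {C : Set} {f : C → Vx} (T : Term C) → WF d (mapT f T) → WF d T
    WF-unmap (vert _) _ = tt
    WF-unmap {f = f} (inner _ _ _) (n , le) = n ∘ cong f , le

    -- Two terms mention at most four branch vertices. A four-element sublist containing them turns
    -- the concrete pair into an instance of a type.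
    conflict-free : ∀ {ys} → 4 ≤ length ys →
      (∀ {τ} → τ ∈ types d → Hom 4 (conflict τ) false ys) →
      ∀ L₁ L₂ → WF d L₁ → WF d L₂ → All (_∈ ys) (supp L₁) → All (_∈ ys) (supp L₂) →
      (∃ λ w → w ∈ supp L₁ × w ∉ supp L₂) → (∃ λ w → w ∈ supp L₂ × w ∉ supp L₁) →
      adjM (ev L₁) (ev L₂) ≡ false
    conflict-free {ys} le hom L₁ L₂ wf₁ wf₂ in₁ in₂ (w , w∈ , w∉) (w' , w'∈ , w'∉)
      with cover _≟_ 4 ys (supp L₁ ++ supp L₂) (AllP.++⁺ in₁ in₂)
             (≤-trans (≤-reflexive (length-++ (supp L₁))) (+-mono-≤ (length-supp L₁) (length-supp L₂))) le
    ... | zs , zs⊑ , zs∋ with lift L₁ zs (AllP.++⁻ˡ (supp L₁) zs∋) | lift L₂ zs (AllP.++⁻ʳ (supp L₁) zs∋)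
    ... | T₁ , refl | T₂ , refl with supp-map T₁ w∈ | supp-map T₂ w'∈
    ... | p , p∈ , refl | q , q∈ , refl =
      hom (types-complete ((T₁ , T₂) , (p , q)) ((WF-unmap T₁ wf₁ , WF-unmap T₂ wf₂) ,
        (p∈ , w∉ ∘ ∈-supp-map T₂) , (q∈ , w'∉ ∘ ∈-supp-map T₁))) zs zs⊑

-- `no-conflict-hom` needs four blocks of more than `biBound t` elements. The list that remains must
-- provide a 4-tuple for `cover` and a branch vertex for each of the `t * (t + t)` grid positions.
keySize : ℕ → ℕ → ℕ
keySize t d = avoidBound 4 (4 * suc (biBound t)) (4 ⊔ t * (t + t)) (length (types d))

-- Enough to forbid all branch vertices and, for every ordered pair, a route with at most `d` inner
-- vertices.
keyConn : ℕ → ℕ → ℕ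
keyConn t d = keySize t d + d * (keySize t d * keySize t d)

length-concatMap-≤ : {A B : Set} (f : A → List B) (d : ℕ) (xs : List A) →
  (∀ {x} → x ∈ xs → length (f x) ≤ d) → length (concatMap f xs) ≤ d * length xs
length-concatMap-≤ f d [] h = z≤n
length-concatMap-≤ f d (x ∷ xs) h = ≤-trans (≤-reflexive (length-++ (f x)))
  (≤-trans (+-mono-≤ (h (here refl)) (length-concatMap-≤ f d xs (h ∘ there))) (≤-reflexive (sym (*-suc d (length xs)))))

length-cartesianProduct : {A B : Set} (xs : List A) (ys : List B) →
  length (cartesianProduct xs ys) ≡ length xs * length ys
length-cartesianProduct [] ys = refl
length-cartesianProduct (x ∷ xs) ys = trans (length-++ (map (x ,_) ys))
  (cong₂ _+_ (length-map (x ,_) ys) (length-cartesianProduct xs ys))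

pathPt-last : {A : Set} (m : ℕ) {a b : A} {f : Fin m → A} → pathPt m a b f (fromℕ (suc m)) ≡ b
pathPt-last zero = refl
pathPt-last (suc m) = pathPt-last m

pathPt-inner : {A : Set} (m : ℕ) {a b : A} {f : Fin m → A} (k : Fin m) → pathPt m a b f (suc (inject₁ k)) ≡ f k
pathPt-inner (suc m) zero = refl
pathPt-inner (suc m) {f = f} (suc k) = pathPt-inner m k

wallEdge-sum : ∀ t {i i' : Fin t} {j j' : Fin (t + t)} → T (wallEdge t (i , j) (i' , j')) →
  suc (toℕ i + toℕ j) ≡ toℕ i' + toℕ j'
wallEdge-sum t {i} {i'} {j} {j'} e with Equivalence.to T-∨ e
... | inj₁ h with Equivalence.to T-∧ h
...   | hi , hj = trans (sym (+-suc (toℕ i) (toℕ j))) (cong₂ _+_ (≡ᵇ⇒≡ (toℕ i) _ hi) (≡ᵇ⇒≡ (suc (toℕ j)) _ hj))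
wallEdge-sum t {i} {i'} {j} {j'} e | inj₂ h with Equivalence.to T-∧ h
...   | hj , h' = cong₂ _+_ (≡ᵇ⇒≡ (suc (toℕ i)) _ (proj₁ (Equivalence.to T-∧ h'))) (≡ᵇ⇒≡ (toℕ j) _ hj)

-- Supplies the private coordinate demanded by a type; the exceptional cases are the same edge and
-- its reversal.
different-pairs : ∀ {m} {x y x' y' : Fin m} → x ≢ y → x' ≢ y' →
  (x ≡ x' × y ≡ y') ⊎ (x ≡ y' × y ≡ x') ⊎ (∃ λ w → w ∈ (x ∷ y ∷ []) × w ∉ (x' ∷ y' ∷ []))
different-pairs {x = x} {y} {x'} {y'} n n' with x ≟ x' | x ≟ y' | y ≟ x' | y ≟ y'
... | yes refl | _ | _ | yes refl = inj₁ (refl , refl)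
... | yes refl | _ | yes refl | no _ = contradiction refl n
... | yes refl | _ | no p | no q = inj₂ (inj₂ (y , there (here refl) , λ { (here e) → p e ; (there (here e)) → q e }))
... | no _ | yes refl | yes refl | _ = inj₂ (inj₁ (refl , refl))
... | no _ | yes refl | no _ | yes refl = contradiction refl n
... | no _ | yes refl | no p | no q = inj₂ (inj₂ (y , there (here refl) , λ { (here e) → p e ; (there (here e)) → q e }))
... | no p | no q | _ | _ = inj₂ (inj₂ (x , here refl , λ { (here e) → p e ; (there (here e)) → q e }))

-- Greedy routing and the induced subdivided wall

module Key (G : Graph) (t : ℕ) (clean : Clean t G) (d : ℕ) where
  open Walks G
  open Bicliques G t clean
  open Subdivision G t clean d

  Linked : ℕ → Vx → Vx → Set
  Linked c u v = ∀ F → length F ≤ c → u ∉ F → v ∉ F → ShortWalk d (_∉ F) u v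

  Ind-start∉ : ∀ {u ps v} → Ind u ps v → u ∉ ps
  Ind-start∉ (ext a f p) (here e) = Adj-irrefl a e
  Ind-start∉ (ext a f p) (there q) = All.lookup f q (inj₂ refl)

  Ind-snoc : ∀ {u ps v} → Ind u ps v → u ≢ v → ∃ λ qs → ps ≡ qs ++ v ∷ [] × v ∉ qs
  Ind-snoc [] n = contradiction refl n
  Ind-snoc {ps = w ∷ ps} {v} (ext a f p) n with w ≟ v
  ... | yes refl with p
  ...   | [] = [] , refl , λ ()
  ...   | ext _ _ p' = contradiction (end-∈ (Ind⇒Walk p')) (Ind-start∉ p)
  Ind-snoc {ps = w ∷ ps} {v} (ext a f p) n | no m with Ind-snoc p m
  ... | qs , refl , v∉ = w ∷ qs , refl , λ { (here e) → m (sym e) ; (there q) → v∉ q }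

  record RoutesOn (W : List Vx) (L : List (Vx × Vx)) (P : Vx × Vx → List Vx) : Set where
    field
      route : ∀ {u v} → (u , v) ∈ L → Ind u (P (u , v) ++ v ∷ []) v
      short : ∀ {e} → e ∈ L → length (P e) ≤ d
      off   : ∀ {e z} → e ∈ L → z ∈ P e → z ∉ W
      disj  : ∀ {e e' z} → e ∈ L → e' ∈ L → z ∈ P e → z ∈ P e' → e ≡ e'

  -- Each new route avoids the other vertices of `W` and all routes already chosen. These are at
  -- most `c` vertices, so robust linkage still provides a short walk.
  routesOn : ∀ {c W} → (∀ {u v} → u ∈ W → v ∈ W → u ≢ v → Linked c u v) →
    ∀ L → Unique L → length W + d * length L ≤ c →
    (∀ {u v} → (u , v) ∈ L → u ∈ W × v ∈ W × u ≢ v) → ∃ (RoutesOn W L)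
  routesOn linked [] _ _ _ = (λ _ → []) , record { route = λ () ; short = λ () ; off = λ () ; disj = λ () }
  routesOn {c} {W} linked ((u , v) ∷ L) (e∉ ∷ uniq) le inW
    with routesOn linked L uniq (≤-trans (+-monoʳ-≤ (length W) (*-monoʳ-≤ d (n≤1+n _))) le) (inW ∘ there)
       | inW (here refl)
  ... | P , R | u∈ , v∈ , u≢v = P' , record { route = route' ; short = short' ; off = off' ; disj = disj' }
    where
      open RoutesOn R
      other? : ∀ z → Dec (¬ (z ≡ u ⊎ z ≡ v))
      other? z = ¬? ((z ≟ u) ⊎-dec (z ≟ v))
      F = filter other? W ++ concatMap P L
      F-len : length F ≤ c
      F-len = ≤-trans (≤-reflexive (length-++ (filter other? W)))
        (≤-trans (+-mono-≤ (length-filter other? W) (≤-trans (length-concatMap-≤ P d L short) (*-monoʳ-≤ d (n≤1+n _)))) le)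
      F-avoids : ∀ {z} → z ∈ W → z ≡ u ⊎ z ≡ v → z ∉ F
      F-avoids z∈ zuv q with ∈-++⁻ (filter other? W) q
      ... | inj₁ p = proj₂ (∈-filter⁻ other? {xs = W} p) zuv
      ... | inj₂ p with find (∈-concatMap⁻ P {xs = L} p)
      ... | e , e∈ , z∈P = off e∈ z∈P z∈
      walk = linked u∈ v∈ u≢v F F-len (F-avoids u∈ (inj₁ refl)) (F-avoids v∈ (inj₂ refl))
      path = shortcut (proj₁ (proj₂ walk))
      snoc = Ind-snoc (proj₁ (proj₂ path)) u≢v
      new = proj₁ snoc
      new⊆ : ∀ {z} → z ∈ new → z ∈ proj₁ path
      new⊆ {z} q = subst (z ∈_) (sym (proj₁ (proj₂ snoc))) (∈-++⁺ˡ q)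
      new∉F : ∀ {z} → z ∈ new → z ∉ F
      new∉F q = proj₂ (proj₂ (proj₂ walk)) (proj₂ (proj₂ (proj₂ path)) (new⊆ q))
      new∉W : ∀ {z} → z ∈ new → z ∉ W
      new∉W {z} q z∈ with (z ≟ u) ⊎-dec (z ≟ v)
      ... | yes (inj₁ refl) = Ind-start∉ (proj₁ (proj₂ path)) (new⊆ q)
      ... | yes (inj₂ refl) = proj₂ (proj₂ snoc) q
      ... | no n = new∉F q (∈-++⁺ˡ (∈-filter⁺ other? z∈ n))
      new∉P : ∀ {z e} → z ∈ new → e ∈ L → z ∉ P e
      new∉P q e∈ z∈ = new∉F q (∈-++⁺ʳ (filter other? W) (∈-concatMap⁺ P (lose e∈ z∈)))
      _≟ₑ_ = ≡-dec _≟_ _≟_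
      P' : Vx × Vx → List Vx
      P' e with e ≟ₑ (u , v)
      ... | yes _ = new
      ... | no _ = P e
      P'-cases : ∀ {e} → e ∈ ((u , v) ∷ L) → (e ≡ (u , v) × P' e ≡ new) ⊎ (e ∈ L × P' e ≡ P e)
      P'-cases {e} e∈ with e ≟ₑ (u , v) | e∈
      ... | yes refl | _ = inj₁ (refl , refl)
      ... | no n | here q = contradiction q n
      ... | no n | there q = inj₂ (q , refl)
      route' : ∀ {a b} → (a , b) ∈ ((u , v) ∷ L) → Ind a (P' (a , b) ++ b ∷ []) b
      route' e∈ with P'-cases e∈
      ... | inj₁ (refl , eq) rewrite eq = subst (λ l → Ind u l v) (proj₁ (proj₂ snoc)) (proj₁ (proj₂ path))
      ... | inj₂ (q , eq) rewrite eq = route q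
      short' : ∀ {e} → e ∈ ((u , v) ∷ L) → length (P' e) ≤ d
      short' e∈ with P'-cases e∈
      ... | inj₁ (refl , eq) rewrite eq = ≤-trans (≤-trans (m≤m+n _ _)
              (≤-reflexive (sym (trans (cong length (proj₁ (proj₂ snoc))) (length-++ new)))))
              (≤-trans (proj₁ (proj₂ (proj₂ path))) (proj₁ (proj₂ (proj₂ walk))))
      ... | inj₂ (q , eq) rewrite eq = short q
      off' : ∀ {e z} → e ∈ ((u , v) ∷ L) → z ∈ P' e → z ∉ W
      off' e∈ with P'-cases e∈
      ... | inj₁ (refl , eq) rewrite eq = new∉W
      ... | inj₂ (q , eq) rewrite eq = off q
      disj' : ∀ {e e' z} → e ∈ ((u , v) ∷ L) → e' ∈ ((u , v) ∷ L) → z ∈ P' e → z ∈ P' e' → e ≡ e'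
      disj' e∈ e'∈ z∈ z∈' with P'-cases e∈ | P'-cases e'∈
      ... | inj₁ (refl , _) | inj₁ (refl , _) = refl
      ... | inj₁ (refl , eq) | inj₂ (q , eq') = contradiction (subst (_ ∈_) eq' z∈') (new∉P (subst (_ ∈_) eq z∈) q)
      ... | inj₂ (q , eq) | inj₁ (refl , eq') = contradiction (subst (_ ∈_) eq z∈) (new∉P (subst (_ ∈_) eq' z∈') q)
      ... | inj₂ (q , eq) | inj₂ (q' , eq') = disj q q' (subst (_ ∈_) eq z∈) (subst (_ ∈_) eq' z∈')

  routes : ∀ {W} → Unique W → length W ≤ keySize t d →
    (∀ {u v} → u ∈ W → v ∈ W → u ≢ v → Linked (keyConn t d) u v) → ∃ (Routes W)
  routes {W} uniq le linked = (λ u v → P (u , v)) , record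
    { route = λ u∈ v∈ n → route (pair u∈ v∈ n)
    ; short = λ u∈ v∈ n → short (pair u∈ v∈ n)
    ; off = λ u∈ v∈ n → off (pair u∈ v∈ n)
    ; disj = λ u∈ v∈ n u'∈ v'∈ n' z∈ z∈' → both (disj (pair u∈ v∈ n) (pair u'∈ v'∈ n') z∈ z∈')
    }
    where
      distinct? : (e : Vx × Vx) → Dec (proj₁ e ≢ proj₂ e)
      distinct? e = ¬? (proj₁ e ≟ proj₂ e)
      L = filter distinct? (cartesianProduct W W)
      pair : ∀ {u v} → u ∈ W → v ∈ W → u ≢ v → (u , v) ∈ L
      pair u∈ v∈ n = ∈-filter⁺ distinct? (∈-cartesianProduct⁺ u∈ v∈) n
      unpair : ∀ {u v} → (u , v) ∈ L → u ∈ W × v ∈ W × u ≢ v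
      unpair q with ∈-filter⁻ distinct? {xs = cartesianProduct W W} q
      ... | q' , n with ∈-cartesianProduct⁻ W W q'
      ... | u∈ , v∈ = u∈ , v∈ , n
      both : ∀ {u v u' v' : Vx} → (u , v) ≡ (u' , v') → u ≡ u' × v ≡ v'
      both refl = refl , refl
      on = routesOn linked L (UniqueP.filter⁺ distinct? (UniqueP.cartesianProduct⁺ uniq uniq))
        (+-mono-≤ le (*-monoʳ-≤ d (≤-trans (length-filter distinct? (cartesianProduct W W))
          (≤-trans (≤-reflexive (length-cartesianProduct W W)) (*-mono-≤ le le))))) unpair
      P = proj₁ on
      open RoutesOn (proj₂ on)

  -- Branch vertices come from the homogeneous list and wall edges become routes. Once conflicts of
  -- all types are absent, an edge of `G` inside this subdivision can only lie along one route.
  module Wall {W ys : List Vx} {P : Vx → Vx → List Vx} (uniq : Unique W) (R : Routes W P) (ys⊑ : ys ⊑ W)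
    (len : 4 ≤ length ys) (branch : Fin (t * (t + t)) → Vx) (branch∈ : ∀ i → branch i ∈ ys)
    (branch-inj : ∀ i j → branch i ≡ branch j → i ≡ j)
    (hom : ∀ {τ} → τ ∈ types d → Hom 4 (conflict uniq R τ) false ys) where
    open Routes R

    b : WallV t → Vx
    b ((i , j) , _) = branch (combine i j)

    b∈ : ∀ v → b v ∈ ys
    b∈ ((i , j) , _) = branch∈ (combine i j)

    bW : ∀ v → b v ∈ W
    bW v = ⊑⇒∈ ys⊑ (b∈ v)

    b-inj : ∀ v v' → b v ≡ b v' → v ≡ v'
    b-inj ((i , j) , k) ((i' , j') , k') e with combine-injective i j i' j' (branch-inj _ _ e)
    ... | refl , refl = cong ((i , j) ,_) (T-irrelevant k k')

    -- Every edge of the wall raises i + j by one, so no edge occurs in both directions.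
    rank : WallV t → ℕ
    rank ((i , j) , _) = toℕ i + toℕ j

    rank-edge : (e : WallE t) → suc (rank (tl (wall t) e)) ≡ rank (hd (wall t) e)
    rank-edge ((((i , j) , _) , ((i' , j') , _)) , e) = wallEdge-sum t {i} {i'} {j} {j'} e

    tail head : WallE t → Vx
    tail e = b (tl (wall t) e)
    head e = b (hd (wall t) e)

    tailW : ∀ e → tail e ∈ W
    tailW e = bW (tl (wall t) e)

    headW : ∀ e → head e ∈ W
    headW e = bW (hd (wall t) e)

    tail≢head : ∀ e → tail e ≢ head e
    tail≢head e q = 1+n≢n (trans (rank-edge e) (cong rank (sym (b-inj (tl (wall t) e) (hd (wall t) e) q))))

    not-reversed : ∀ e e' → ¬ (tail e ≡ head e' × head e ≡ tail e')
    not-reversed e e' (q , q') = n≢2+n (trans (cong rank (sym (b-inj (hd (wall t) e) (tl (wall t) e') q'))) (trans (sym (rank-edge e))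
        (cong suc (trans (cong rank (b-inj (tl (wall t) e) (hd (wall t) e') q)) (sym (rank-edge e'))))))
      where
        n≢2+n : ∀ {n} → n ≢ suc (suc n)
        n≢2+n ()

    edge-≡ : ∀ e e' → tail e ≡ tail e' → head e ≡ head e' → e ≡ e'
    edge-≡ ((u , v) , k) ((u' , v') , k') q q' with b-inj u u' q | b-inj v v' q'
    ... | refl | refl = cong ((u , v) ,_) (T-irrelevant k k')

    inn : WallE t → List Vx
    inn e = P (tail e) (head e)

    -- Each wall edge is subdivided as often as its route has inner vertices; the numbers may vary,
    -- as cleanness excludes every subdivision.
    m : WallE t → ℕ
    m e = length (inn e)

    S = subdivide (wall t) m

    emb' : EV S → Vx
    emb' (inj₁ v) = b v
    emb' (inj₂ (e , k)) = lookup (inn e) k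

    term : EV S → Term Vx
    term (inj₁ v) = vert (b v)
    term (inj₂ (e , k)) = inner (tail e) (head e) (toℕ k)

    ev-term : ∀ x → ev uniq R (term x) ≡ just (emb' x)
    ev-term (inj₁ v) = refl
    ev-term (inj₂ (e , k)) = at-lookup (inn e) k

    pt : (e : WallE t) → Fin (suc (suc (m e))) → EV S
    pt e = pathPt (m e) (inj₁ (tl (wall t) e)) (inj₁ (hd (wall t) e)) (λ k → inj₂ (e , k))

    emb-pathPt : ∀ ps {x y} (f : Fin (length ps) → EV S) → (∀ k → emb' (f k) ≡ lookup ps k) →
      ∀ k → emb' (pathPt (length ps) x y f k) ≡ nth (emb' x) (ps ++ emb' y ∷ []) (toℕ k)
    emb-pathPt [] f h zero = refl
    emb-pathPt [] f h (suc zero) = refl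
    emb-pathPt (p ∷ ps) f h zero = refl
    emb-pathPt (p ∷ ps) {y = y} f h (suc k) = trans (emb-pathPt ps (f ∘ suc) (h ∘ suc) k)
      (cong (λ z → nth z (ps ++ emb' y ∷ []) (toℕ k)) (h zero))

    emb-pt : ∀ e k → emb' (pt e k) ≡ nth (tail e) (inn e ++ head e ∷ []) (toℕ k)
    emb-pt e = emb-pathPt (inn e) (λ k → inj₂ (e , k)) (λ _ → refl)

    ind : ∀ e → Ind (tail e) (inn e ++ head e ∷ []) (head e)
    ind e = route (tailW e) (headW e) (tail≢head e)

    bound : ∀ e (k : Fin (suc (suc (m e)))) → toℕ k ≤ length (inn e ++ head e ∷ [])
    bound e k = ≤-trans (s≤s⁻¹ (toℕ<n k)) (≤-reflexive (sym (trans (length-++ (inn e)) (+-comm (m e) 1))))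

    pt-inj : ∀ e k k' → emb' (pt e k) ≡ emb' (pt e k') → k ≡ k'
    pt-inj e k k' q = toℕ-injective (Ind-inj (ind e) (bound e k) (bound e k')
      (trans (sym (emb-pt e k)) (trans q (emb-pt e k'))))

    pt-adj : ∀ e k k' → Adj G (emb' (pt e k)) (emb' (pt e k')) ⇔ Near (toℕ k) (toℕ k')
    pt-adj e k k' = subst₂ (λ x y → Adj G x y ⇔ Near (toℕ k) (toℕ k')) (sym (emb-pt e k)) (sym (emb-pt e k'))
      (Ind-adjIff (ind e) (bound e k) (bound e k'))

    on-head : ∀ e → inj₁ (hd (wall t) e) ≡ pt e (fromℕ (suc (m e)))
    on-head e = sym (pathPt-last (m e))

    on-inner : ∀ e k → inj₂ (e , k) ≡ pt e (suc (inject₁ k))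
    on-inner e k = sym (pathPt-inner (m e) k)

    emb-inj : ∀ x y → emb' x ≡ emb' y → x ≡ y
    emb-inj (inj₁ v) (inj₁ v') q = cong inj₁ (b-inj v v' q)
    emb-inj (inj₁ v) (inj₂ (e , k)) q =
      contradiction (subst (_∈ W) q (bW v)) (off (tailW e) (headW e) (tail≢head e) (∈-lookup k))
    emb-inj (inj₂ (e , k)) (inj₁ v) q =
      contradiction (subst (_∈ W) (sym q) (bW v)) (off (tailW e) (headW e) (tail≢head e) (∈-lookup k))
    emb-inj (inj₂ (e , k)) (inj₂ (e' , k')) q
      with disj (tailW e) (headW e) (tail≢head e) (tailW e') (headW e') (tail≢head e') (∈-lookup k) (subst (_∈ inn e') (sym q) (∈-lookup k'))
    ... | qt , qh with edge-≡ e e' qt qh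
    ... | refl = trans (on-inner e k) (trans (cong (pt e)
      (pt-inj e (suc (inject₁ k)) (suc (inject₁ k')) (trans (cong emb' (sym (on-inner e k))) (trans q (cong emb' (on-inner e k')))))) (sym (on-inner e k')))

    WF-term : ∀ x → WF d (term x)
    WF-term (inj₁ _) = tt
    WF-term (inj₂ (e , k)) = tail≢head e , ≤-trans (toℕ<n k) (short (tailW e) (headW e) (tail≢head e))

    supp-term : ∀ x → All (_∈ ys) (supp (term x))
    supp-term (inj₁ v) = b∈ v ∷ []
    supp-term (inj₂ (e , k)) = b∈ (tl (wall t) e) ∷ b∈ (hd (wall t) e) ∷ []

    non-adj : ∀ x y → (∃ λ w → w ∈ supp (term x) × w ∉ supp (term y)) →
      (∃ λ w → w ∈ supp (term y) × w ∉ supp (term x)) → ¬ Adj G (emb' x) (emb' y)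
    non-adj x y w w' = false⇒¬T (subst₂ (λ a b → adjM a b ≡ false) (ev-term x) (ev-term y)
      (conflict-free uniq R len hom (term x) (term y) (WF-term x) (WF-term y) (supp-term x) (supp-term y) w w'))

    OnEdge : EV S → EV S → Set
    OnEdge x y = ∃ λ e → ∃₂ λ k k' → x ≡ pt e k × y ≡ pt e k'

    vert-inner : ∀ v e k → Adj G (b v) (lookup (inn e) k) → OnEdge (inj₁ v) (inj₂ (e , k))
    vert-inner v e k a = cases (b v ≟ tail e) (b v ≟ head e)
      where
        cases : Dec (b v ≡ tail e) → Dec (b v ≡ head e) → OnEdge (inj₁ v) (inj₂ (e , k))
        cases (yes q) _ = e , zero , suc (inject₁ k) , cong inj₁ (b-inj v (tl (wall t) e) q) , on-inner e k
        cases (no _) (yes q) = e , fromℕ (suc (m e)) , suc (inject₁ k) ,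
          trans (cong inj₁ (b-inj v (hd (wall t) e) q)) (on-head e) , on-inner e k
        -- `b v` is private to the first term and `tail e` to the second, so a type forbids this
        -- adjacency.
        cases (no n) (no n') = contradiction a (non-adj (inj₁ v) (inj₂ (e , k))
          (b v , here refl , λ { (here q) → n q ; (there (here q)) → n' q })
          (tail e , here refl , λ { (here q) → n (sym q) }))

    inner-inner : ∀ e k e' k' → Adj G (lookup (inn e) k) (lookup (inn e') k') → OnEdge (inj₂ (e , k)) (inj₂ (e' , k'))
    inner-inner e k e' k' a =
      cases (different-pairs (tail≢head e) (tail≢head e')) (different-pairs (tail≢head e') (tail≢head e))
      where
        same : ∀ e k e' k' → e ≡ e' → OnEdge (inj₂ (e , k)) (inj₂ (e' , k'))
        same e k .e k' refl = e , suc (inject₁ k) , suc (inject₁ k') , on-inner e k , on-inner e k'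
        cases : (tail e ≡ tail e' × head e ≡ head e') ⊎ (tail e ≡ head e' × head e ≡ tail e') ⊎ _ →
          (tail e' ≡ tail e × head e' ≡ head e) ⊎ (tail e' ≡ head e × head e' ≡ tail e) ⊎ _ →
          OnEdge (inj₂ (e , k)) (inj₂ (e' , k'))
        cases (inj₁ (q , q')) _ = same e k e' k' (edge-≡ e e' q q')
        cases (inj₂ (inj₁ q)) _ = ⊥-elim (not-reversed e e' q)
        cases (inj₂ (inj₂ _)) (inj₁ (q , q')) = same e k e' k' (sym (edge-≡ e' e q q'))
        cases (inj₂ (inj₂ _)) (inj₂ (inj₁ q)) = ⊥-elim (not-reversed e' e q)
        cases (inj₂ (inj₂ w)) (inj₂ (inj₂ w')) = contradiction a (non-adj (inj₂ (e , k)) (inj₂ (e' , k')) w w')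

    OnEdge-sym : ∀ {x y} → OnEdge x y → OnEdge y x
    OnEdge-sym (e , k , k' , p , q) = e , k' , k , q , p

    on-edge : ∀ x y → Adj G (emb' x) (emb' y) → OnEdge x y
    on-edge (inj₁ v) (inj₁ v') a = contradiction a (non-adj (inj₁ v) (inj₁ v')
      (b v , here refl , λ { (here q) → Adj-irrefl a q }) (b v' , here refl , λ { (here q) → Adj-irrefl a (sym q) }))
    on-edge (inj₁ v) (inj₂ (e , k)) a = vert-inner v e k a
    on-edge (inj₂ (e , k)) (inj₁ v) a = OnEdge-sym (vert-inner v e k (Adj-sym a))
    on-edge (inj₂ (e , k)) (inj₂ (e' , k')) a = inner-inner e k e' k' a

    step : ∀ {l} (k k' : Fin (suc l)) → suc (toℕ k) ≡ toℕ k' → ∃ λ s → inject₁ s ≡ k × suc s ≡ k'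
    step k (suc s) q = s , toℕ-injective (trans (toℕ-inject₁ s) (sym (suc-injective q))) , refl

    copy : InducedCopy G Sub.⊤ (toPattern S)
    copy = record
      { emb = emb'
      ; inj = emb-inj
      ; inU = λ _ → ∈⊤
      ; adjIff = λ x y → mk⇔ (to x y) (from x y)
      }
      where
        consecutive : ∀ e s → Adj G (emb' (pt e (inject₁ s))) (emb' (pt e (suc s)))
        consecutive e s = Equivalence.from (pt-adj e (inject₁ s) (suc s)) (inj₁ (cong suc (toℕ-inject₁ s)))
        to : ∀ x y → PAdj (toPattern S) x y → Adj G (emb' x) (emb' y)
        to x y ((e , s) , inj₁ (refl , refl)) = consecutive e s
        to x y ((e , s) , inj₂ (refl , refl)) = Adj-sym (consecutive e s)
        near : ∀ e k k' → Near (toℕ k) (toℕ k') → PAdj (toPattern S) (pt e k) (pt e k')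
        near e k k' (inj₁ q) with step k k' q
        ... | s , refl , refl = (e , s) , inj₁ (refl , refl)
        near e k k' (inj₂ q) with step k' k q
        ... | s , refl , refl = (e , s) , inj₂ (refl , refl)
        from : ∀ x y → Adj G (emb' x) (emb' y) → PAdj (toPattern S) x y
        from x y a with on-edge x y a
        ... | e , k , k' , refl , refl = near e k k' (Equivalence.to (pt-adj e k k') a)

  -- No type can hold homogeneously on a long list, so `ramseyAvoid` leaves a list free of all
  -- conflicts that is large enough for an induced subdivided wall.
  no-routes : ∀ {W P} → Unique W → Routes W P → ¬ (keySize t d ≤ length W)
  no-routes {W} {P} uniq R le = found (ramseyAvoid 4 (4 * suc (biBound t)) (4 ⊔ t * (t + t)) (types d) (conflict uniq R) W le
      (λ {τ} {ys} τ∈ s l → no-conflict-hom uniq R {τ} (types-valid τ∈) s (blocks 4 (suc (biBound t)) ys l)))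
    where
      found : ¬ (∃ λ ys → ys ⊑ W × 4 ⊔ t * (t + t) ≤ length ys × (∀ {τ} → τ ∈ types d → Hom 4 (conflict uniq R τ) false ys))
      found (ys , ys⊑ , len , hom) = proj₁ (proj₂ (proj₂ clean)) W.m W.copy
        where
          sel = select (t * (t + t)) (AllPairs-resp-⊑ ys⊑ uniq) (≤-trans (m≤n⊔m 4 (t * (t + t))) len)
          module W = Wall uniq R ys⊑ (≤-trans (m≤m⊔n 4 (t * (t + t))) len) (proj₁ sel) (proj₁ (proj₂ sel)) (proj₂ (proj₂ sel)) hom

  -- `keyConn` pays for the routes between `keySize` branch vertices only, so `W` is truncated
  -- first.
  not-all-linked : ∀ {W} → Unique W → keySize t d ≤ length W →
    ¬ (∀ {u v} → u ∈ W → v ∈ W → u ≢ v → Linked (keyConn t d) u v)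
  not-all-linked {W} uniq le linked = no-routes (AllPairs-resp-⊑ s uniq)
      (proj₂ (routes (AllPairs-resp-⊑ s uniq) (≤-reflexive size) (λ u∈ v∈ → linked (⊑⇒∈ s u∈) (⊑⇒∈ s v∈))))
      (≤-reflexive (sym size))
    where
      s = take-⊆ (keySize t d) W
      size : length (take (keySize t d) W) ≡ keySize t d
      size = trans (length-take (keySize t d) W) (m≤n⇒m⊓n≡m le)

-- Scattered blocks

does-true : {Q : Set} (D : Dec Q) → does D ≡ true → Q
does-true (yes q) _ = q

does-false : {Q : Set} (D : Dec Q) → does D ≡ false → ¬ Q
does-false (no ¬q) _ = ¬q

module _ {m : ℕ} where

  fromListˢ : List (Fin m) → Subset m
  fromListˢ xs = Vec.tabulate λ v → does (v ∈? xs)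

  ∈-fromListˢ⁺ : ∀ {v xs} → v ∈ xs → v Sub.∈ fromListˢ xs
  ∈-fromListˢ⁺ {v} {xs} v∈ = lookup⇒[]= v _ (trans (lookup∘tabulate _ v) (dec-true (v ∈? xs) v∈))

  ∈-fromListˢ⁻ : ∀ {v xs} → v Sub.∈ fromListˢ xs → v ∈ xs
  ∈-fromListˢ⁻ {v} {xs} q with v ∈? xs | trans (sym (lookup∘tabulate (λ v → does (v ∈? xs)) v)) ([]=⇒lookup q)
  ... | yes p | _ = p
  ... | no _ | ()

-- Listed in decreasing order, so that the head of the list is the larger end of every pair it forms.
elements : ∀ {m} → Subset m → List (Fin m)
elements [] = []
elements (true ∷ s) = map suc (elements s) ++ zero ∷ []
elements (false ∷ s) = map suc (elements s)

length-elements : ∀ {m} (s : Subset m) → length (elements s) ≡ ∣ s ∣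
length-elements [] = refl
length-elements (true ∷ s) = trans (length-++ (map suc (elements s)))
  (trans (+-comm _ 1) (cong suc (trans (length-map suc (elements s)) (length-elements s))))
length-elements (false ∷ s) = trans (length-map suc (elements s)) (length-elements s)

elements-sound : ∀ {m} (s : Subset m) {v} → v ∈ elements s → v Sub.∈ s
elements-sound (true ∷ s) q with ∈-++⁻ (map suc (elements s)) q
... | inj₂ (here refl) = Vec.here
... | inj₁ q' with ∈-map⁻ suc q'
... | w , w∈ , refl = Vec.there (elements-sound s w∈)
elements-sound (false ∷ s) q with ∈-map⁻ suc q
... | w , w∈ , refl = Vec.there (elements-sound s w∈)

elements-complete : ∀ {m} (s : Subset m) {v} → v Sub.∈ s → v ∈ elements s
elements-complete (true ∷ s) Vec.here = ∈-++⁺ʳ (map suc (elements s)) (here refl)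
elements-complete (true ∷ s) (Vec.there q) = ∈-++⁺ˡ (∈-map⁺ suc (elements-complete s q))
elements-complete (false ∷ s) (Vec.there q) = ∈-map⁺ suc (elements-complete s q)

Decreasing : ∀ {m} → List (Fin m) → Set
Decreasing = AllPairs λ u v → toℕ v < toℕ u

elements-decreasing : ∀ {m} (s : Subset m) → Decreasing (elements s)
elements-decreasing [] = []
elements-decreasing (true ∷ s) = AllPairsP.++⁺ (AllPairsP.map⁺ (AllPairs.map s≤s (elements-decreasing s))) ([] ∷ [])
    (AllP.map⁺ (All.tabulate λ _ → s≤s z≤n ∷ []))
elements-decreasing (false ∷ s) = AllPairsP.map⁺ (AllPairs.map s≤s (elements-decreasing s))

Decreasing⇒Unique : ∀ {m} {xs : List (Fin m)} → Decreasing xs → Unique xs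
Decreasing⇒Unique = AllPairs.map λ { lt refl → <-irrefl refl lt }

length-≤-∣fromListˢ∣ : ∀ {m} {xs : List (Fin m)} → Unique xs → length xs ≤ ∣ fromListˢ xs ∣
length-≤-∣fromListˢ∣ {xs = xs} u = ≤-trans
  (Unique-⊆-length _≟_ u (λ q → elements-complete (fromListˢ xs) (∈-fromListˢ⁺ q)))
  (≤-reflexive (length-elements (fromListˢ xs)))

-- There are finitely many lists of bounded length over a finite vertex set, so separability can be
-- decided by search.
anyList? : ∀ {m} {Q : List (Fin m) → Set} → Decidable Q → ∀ c → Dec (∃ λ F → length F ≤ c × Q F)
anyList? Q? zero = map′ (λ q → [] , z≤n , q) (λ { ([] , _ , q) → q }) (Q? [])
anyList? Q? (suc c) = map′
  (λ { (inj₁ q) → [] , z≤n , q ; (inj₂ (a , F , le , q)) → a ∷ F , s≤s le , q })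
  (λ { ([] , _ , q) → inj₁ q ; (a ∷ F , s≤s le , q) → inj₂ (a , F , le , q) })
  (Q? [] ⊎-dec any? λ a → anyList? (Q? ∘ (a ∷_)) c)

triples : List (Fin 3 × Fin 3 × Fin 3)
triples = cartesianProduct (allFin 3) (cartesianProduct (allFin 3) (allFin 3))

Distinct₃ : Fin 3 × Fin 3 × Fin 3 → Set
Distinct₃ (p , q , r) = p ≢ q × p ≢ r × q ≢ r

distinct₃? : Decidable Distinct₃
distinct₃? (p , q , r) = ¬? (p ≟ q) ×-dec ¬? (p ≟ r) ×-dec ¬? (q ≟ r)

freeBound : ℕ → ℕ → ℕ
freeBound c N = avoidBound 3 (3 * suc c) (3 ⊔ N) (length triples)

module _ {m : ℕ} where

  -- Homogeneously w ∈ F u v would put more than c different w into a single set F u v.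
  free-set : ∀ c N (F : Fin m → Fin m → List (Fin m)) → (∀ u v → length (F u v) ≤ c) →
    ∀ {xs} → Unique xs → freeBound c N ≤ length xs →
    ∃ λ ys → ys ⊑ xs × N ≤ length ys ×
      (∀ {u v w} → u ∈ ys → v ∈ ys → w ∈ ys → w ≢ u → w ≢ v → u ≢ v → w ∉ F u v)
  free-set c N F F-len {xs} uniq le =
    finish (ramseyAvoid 3 (3 * suc c) (3 ⊔ N) triples f xs le (λ τ∈ s l → bad s (blocks 3 (suc c) _ l)))
    where
      InF : Fin 3 × Fin 3 × Fin 3 → Vec (Fin m) 3 → Set
      InF (p , q , r) zs = Distinct₃ (p , q , r) × Vec.lookup zs p ∈ F (Vec.lookup zs q) (Vec.lookup zs r)
      inF? : ∀ τ zs → Dec (InF τ zs)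
      inF? (p , q , r) zs = distinct₃? (p , q , r) ×-dec (Vec.lookup zs p ∈? F (Vec.lookup zs q) (Vec.lookup zs r))
      f : Fin 3 × Fin 3 × Fin 3 → Vec (Fin m) 3 → Bool
      f τ zs = does (inF? τ zs)
      bad : ∀ {τ ys} → ys ⊑ xs → Blocks (Fin m) 3 (suc c) ys → ¬ Hom 3 (f τ) true ys
      bad {τ@(p , q , r)} {ys} s bl hom = ≤⇒≯ (≤-trans
          (Unique-⊆-length _≟_ (AllPairs-resp-⊑ (⊑-trans (block-⊑ p) s) uniq) inF) (F-len b₀ c₀)) (block-len p)
        where
          open Blocks bl
          first : ∀ c → ∃ (_∈ block c)
          first c with block c | block-len c
          ... | x ∷ _ | _ = x , here refl
          base = Vec.tabulate (proj₁ ∘ first)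
          b₀ = proj₁ (first q)
          c₀ = proj₁ (first r)
          x∈ : ∀ {a} → a ∈ block p → ∀ c → Vec.lookup (base [ p ]≔ a) c ∈ block c
          x∈ {a} a∈ c with c ≟ p
          ... | yes refl = subst (_∈ block p) (sym (lookup∘update p base a)) a∈
          ... | no n = subst (_∈ block c) (sym (trans (lookup∘update′ n base a) (lookup∘tabulate (proj₁ ∘ first) c))) (proj₂ (first c))
          inF : ∀ {a} → a ∈ block p → a ∈ F b₀ c₀
          inF {a} a∈ with does-true (inF? τ (base [ p ]≔ a)) (hom (base [ p ]≔ a) (transversal (base [ p ]≔ a) (x∈ a∈)))
          ... | (p≢q , p≢r , _) , h = subst₂ (λ x l → x ∈ l) (lookup∘update p base a)
            (cong₂ F (trans (lookup∘update′ (p≢q ∘ sym) base a) (lookup∘tabulate (proj₁ ∘ first) q))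
                     (trans (lookup∘update′ (p≢r ∘ sym) base a) (lookup∘tabulate (proj₁ ∘ first) r))) h
      finish : (∃ λ ys → ys ⊑ xs × 3 ⊔ N ≤ length ys × (∀ {τ} → τ ∈ triples → Hom 3 (f τ) false ys)) →
        ∃ λ ys → ys ⊑ xs × N ≤ length ys ×
          (∀ {u v w} → u ∈ ys → v ∈ ys → w ∈ ys → w ≢ u → w ≢ v → u ≢ v → w ∉ F u v)
      finish (ys , s , len , hom) = ys , s , ≤-trans (m≤n⊔m 3 N) len , free
        where
          free : ∀ {u v w} → u ∈ ys → v ∈ ys → w ∈ ys → w ≢ u → w ≢ v → u ≢ v → w ∉ F u v
          free {u} {v} {w} u∈ v∈ w∈ wu wv uv h
            with cover _≟_ 3 ys (w ∷ u ∷ v ∷ []) (w∈ ∷ u∈ ∷ v∈ ∷ []) ≤-refl (≤-trans (m≤m⊔n 3 N) len)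
          ... | zs , zs⊑ , (w' ∷ u' ∷ v' ∷ []) with index-toList w' | index-toList u' | index-toList v'
          ... | p , refl | q , refl | r , refl = does-false (inF? (p , q , r) zs)
            (hom (∈-cartesianProduct⁺ (∈-allFin p) (∈-cartesianProduct⁺ (∈-allFin q) (∈-allFin r))) zs zs⊑)
            (((λ { refl → wu refl }) , (λ { refl → wv refl }) , (λ { refl → uv refl })) , h)

restrict : ∀ {G U U' x y} (P : IPath G U x y) → (∀ {v} → OnPath v P → v Sub.∈ U') → IPath G U' x y
restrict P h = record
  { len = len P ; vx = vx P ; inj = IPath.inj P ; start = start P ; end = end P
  ; inU = λ i → h (i , refl) ; adjIff = IPath.adjIff P }

-- The first summand feeds the Ramsey steps, for separability and then for a free set; the second
-- leaves `K` paths per pair after at most `keyConn t d * (K * K)` deletions.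
blockBound : ℕ → ℕ → ℕ → ℕ
blockBound t d K = avoidBound 2 (keySize t d) (freeBound (keyConn t d) K) 1 + (K + keyConn t d * (K * K))

module Separate (G : Graph) (t : ℕ) (clean : Clean t G) (d : ℕ) where
  open Walks G
  open Bicliques G t clean
  open Key G t clean d

  c = keyConn t d

  Hit : Vx → Vx → List Vx → Set
  Hit u v F = (u ∉ F × v ∉ F) × ¬ ShortWalk d (_∉ F) u v

  Separable : Vx → Vx → Set
  Separable u v = ∃ λ F → length F ≤ c × Hit u v F

  separable? : ∀ u v → Dec (Separable u v)
  separable? u v = anyList? (λ F → (¬? (u ∈? F) ×-dec ¬? (v ∈? F)) ×-dec
    ¬? (shortWalk? d (λ z → ¬? (z ∈? F)) u v)) c

  Separable-sym : ∀ {u v} → Separable u v → Separable v u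
  Separable-sym (F , le , (u∉ , v∉) , ¬w) = F , le , (v∉ , u∉) , ¬w ∘ ShortWalk-sym v∉

  ¬Separable⇒Linked : ∀ {u v} → ¬ Separable u v → Linked c u v
  ¬Separable⇒Linked {u} {v} ¬s F le u∉ v∉ with shortWalk? d (λ z → ¬? (z ∈? F)) u v
  ... | yes w = w
  ... | no ¬w = contradiction (F , le , (u∉ , v∉) , ¬w) ¬s

  -- Pairs that are not separable are robustly linked, so a large set of such pairs contradicts
  -- `not-all-linked`.
  separated-subset : ∀ N {xs} → Unique xs → avoidBound 2 (keySize t d) N 1 ≤ length xs →
    ∃ λ ys → ys ⊑ xs × N ≤ length ys × (∀ {u v} → u ∈ ys → v ∈ ys → u ≢ v → Separable u v)
  separated-subset N {xs} uniq le =
    finish (ramseyAvoid 2 (keySize t d) N (tt ∷ []) (λ _ → linkage) xs le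
      (λ _ s l hom → not-all-linked (AllPairs-resp-⊑ s uniq) l λ u∈ v∈ n → ¬Separable⇒Linked (linked hom u∈ v∈ n)))
    where
      linkage : Vec Vx 2 → Bool
      linkage = onPair λ u v → does (¬? (separable? u v))
      linked : ∀ {ys} → Hom 2 linkage true ys → ∀ {u v} → u ∈ ys → v ∈ ys → u ≢ v → ¬ Separable u v
      linked hom {u} {v} u∈ v∈ n with pair-⊑ u∈ v∈ n
      ... | inj₁ s = does-true (¬? (separable? u v)) (hom (u ∷ v ∷ []) s)
      ... | inj₂ s = does-true (¬? (separable? v u)) (hom (v ∷ u ∷ []) s) ∘ Separable-sym
      finish : (∃ λ ys → ys ⊑ xs × N ≤ length ys × (∀ {τ} → τ ∈ (tt ∷ []) → Hom 2 linkage false ys)) →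
        ∃ λ ys → ys ⊑ xs × N ≤ length ys × (∀ {u v} → u ∈ ys → v ∈ ys → u ≢ v → Separable u v)
      finish (ys , s , len , hom) = ys , s , len , sep
        where
          stable-sep : ∀ u v → linkage (u ∷ v ∷ []) ≡ false → Separable u v
          stable-sep u v e = decidable-stable (separable? u v) (does-false (¬? (separable? u v)) e)
          sep : ∀ {u v} → u ∈ ys → v ∈ ys → u ≢ v → Separable u v
          sep {u} {v} u∈ v∈ n with pair-⊑ u∈ v∈ n
          ... | inj₁ s' = stable-sep u v (hom (here refl) _ s')
          ... | inj₂ s' = Separable-sym (stable-sep v u (hom (here refl) _ s'))

  separator : Vx → Vx → List Vx
  separator u v with separable? u v
  ... | yes (F , _) = F
  ... | no _ = []

  separator-len : ∀ u v → length (separator u v) ≤ c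
  separator-len u v with separable? u v
  ... | yes (_ , le , _) = le
  ... | no _ = z≤n

  separator-hit : ∀ {u v} → Separable u v → Hit u v (separator u v)
  separator-hit {u} {v} s with separable? u v
  ... | yes (_ , _ , h) = h
  ... | no ¬s = contradiction s ¬s

  -- The union of separators also runs over the diagonal. The empty walk joins `u` to itself
  -- whatever is deleted, so the default `[]` applies there.
  separator-refl : ∀ u → separator u u ≡ []
  separator-refl u with separable? u u
  ... | yes (_ , _ , _ , ¬w) = contradiction ([] , [] , z≤n , λ ()) ¬w
  ... | no _ = refl

  -- The size is exactly `K` because `A` is a union over pairs and its length must be bounded in
  -- terms of `K`.
  record Scattered (K : ℕ) (B : Subset (n G)) (A : List Vx) (ys : List Vx) : Set where
    field
      decreasing : Decreasing ys
      size   : length ys ≡ K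
      inB    : ∀ {z} → z ∈ ys → z Sub.∈ B
      offA   : ∀ {z} → z ∈ ys → z ∉ A
      A-len  : length A ≤ c * (K * K)
      stable : ∀ {u v} → u ∈ ys → v ∈ ys → u ≢ v → ¬ ShortWalk d (_∉ A) u v

  scattered : ∀ K (B : Subset (n G)) → blockBound t d K ≤ ∣ B ∣ → ∃₂ (Scattered K B)
  scattered K B le = finish (separated-subset _ (Decreasing⇒Unique (elements-decreasing B))
      (≤-trans (m≤m+n _ _) (≤-trans le (≤-reflexive (sym (length-elements B))))))
    where
      finish₂ : ∀ {ys} → ys ⊑ elements B → K ≤ length ys → (∀ {u v} → u ∈ ys → v ∈ ys → u ≢ v → Separable u v) →
        (∀ {u v w} → u ∈ ys → v ∈ ys → w ∈ ys → w ≢ u → w ≢ v → u ≢ v → w ∉ separator u v) → ∃₂ (Scattered K B)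
      finish₂ {ys} s len sep free = cut , zs , record
        { decreasing = AllPairs-resp-⊑ (⊑-trans s' s) (elements-decreasing B)
        ; size = size
        ; inB = λ z∈ → elements-sound B (⊑⇒∈ (⊑-trans s' s) z∈)
        ; offA = offA
        ; A-len = ≤-trans (length-concatMap-≤ sep-of c (cartesianProduct zs zs) (λ {e} _ → separator-len (proj₁ e) (proj₂ e)))
            (≤-reflexive (cong (c *_) (trans (length-cartesianProduct zs zs) (cong₂ _*_ size size))))
        ; stable = λ { u∈ v∈ n (ps , w , l , ok) → proj₂ (separator-hit (sep (⊑⇒∈ s' u∈) (⊑⇒∈ s' v∈) n))
            (ps , w , l , λ q h → ok q (∈-concatMap⁺ sep-of (lose (∈-cartesianProduct⁺ u∈ v∈) h))) }
        }
        where
          zs = take K ys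
          s' = take-⊆ K ys
          size : length zs ≡ K
          size = trans (length-take K ys) (m≤n⇒m⊓n≡m len)
          sep-of : Vx × Vx → List Vx
          sep-of e = separator (proj₁ e) (proj₂ e)
          cut = concatMap sep-of (cartesianProduct zs zs)
          -- A separator avoids its own two ends by definition and the other chosen vertices by the
          -- free-set property.
          offSep : ∀ {z u v} → z ∈ zs → u ∈ zs → v ∈ zs → z ∉ separator u v
          offSep {z} {u} {v} z∈ u∈ v∈ h with u ≟ v
          ... | yes refl with separator u u | separator-refl u
          offSep z∈ u∈ v∈ () | yes refl | .[] | refl
          offSep {z} {u} {v} z∈ u∈ v∈ h | no n with separator-hit (sep (⊑⇒∈ s' u∈) (⊑⇒∈ s' v∈) n) | z ≟ u | z ≟ v
          ... | (u∉ , _) , _ | yes refl | _ = u∉ h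
          ... | (_ , v∉) , _ | no _ | yes refl = v∉ h
          ... | _ | no zu | no zv = free (⊑⇒∈ s' u∈) (⊑⇒∈ s' v∈) (⊑⇒∈ s' z∈) zu zv n h
          offA : ∀ {z} → z ∈ zs → z ∉ cut
          offA z∈ h with find (∈-concatMap⁻ sep-of {xs = cartesianProduct zs zs} h)
          ... | (u , v) , e∈ , h' with ∈-cartesianProduct⁻ zs zs e∈
          ... | u∈ , v∈ = offSep z∈ u∈ v∈ h'
      finish₁ : ∀ {ys} → ys ⊑ elements B → (∀ {u v} → u ∈ ys → v ∈ ys → u ≢ v → Separable u v) → (∃ λ zs → zs ⊑ ys × K ≤ length zs ×
        (∀ {u v w} → u ∈ zs → v ∈ zs → w ∈ zs → w ≢ u → w ≢ v → u ≢ v → w ∉ separator u v)) → ∃₂ (Scattered K B)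
      finish₁ s sep (zs , s' , len , free) = finish₂ (⊑-trans s' s) len (λ u∈ v∈ → sep (⊑⇒∈ s' u∈) (⊑⇒∈ s' v∈)) free
      finish : (∃ λ ys → ys ⊑ elements B × freeBound c K ≤ length ys × (∀ {u v} → u ∈ ys → v ∈ ys → u ≢ v → Separable u v)) →
        ∃₂ (Scattered K B)
      finish (ys , s , len , sep) = finish₁ s sep (free-set c K separator separator-len
        (AllPairs-resp-⊑ s (Decreasing⇒Unique (elements-decreasing B))) len)

  -- Deleted vertices lie outside `ys`, so by internal disjointness each destroys at most one of the
  -- `k₁` paths of a pair, and at least `K` survive.
  surviving-block : ∀ {K k₁ B A ys} → K + c * (K * K) ≤ k₁ → Scattered K B A ys → StrongBlock G Sub.⊤ k₁ B →
    StrongBlock G (∁ (fromListˢ A)) K (fromListˢ ys)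
  surviving-block {K} {k₁} {B} {A} {ys} le sc (_ , coll , within , across) =
      ≤-trans (≤-reflexive (sym size)) (length-≤-∣fromListˢ∣ (Decreasing⇒Unique decreasing)) , coll' ,
      (λ x y hx hy lt i j n → within x y (toB hx) (toB hy) lt (pick hx hy lt i) (pick hx hy lt j) (n ∘ pick-inj hx hy lt i j)) ,
      (λ x y x' y' hx hy lt hx' hy' lt' n i j → across x y x' y' (toB hx) (toB hy) lt (toB hx') (toB hy') lt' n
        (pick hx hy lt i) (pick hx' hy' lt' j))
    where
      open Scattered sc
      toB : ∀ {x} → x Sub.∈ fromListˢ ys → x Sub.∈ B
      toB h = inB (∈-fromListˢ⁻ h)
      module _ {x y} (hx : x Sub.∈ fromListˢ ys) (hy : y Sub.∈ fromListˢ ys) (lt : toℕ x < toℕ y) where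
        path : Fin k₁ → IPath G Sub.⊤ x y
        path = coll x y (toB hx) (toB hy) lt
        one : ∀ {i j v} → v ∈ A → OnPath v (path i) → OnPath v (path j) → i ≡ j
        one {i} {j} {v} v∈ p q with i ≟ j
        ... | yes e = e
        ... | no n with Equivalence.to (proj₂ (within x y (toB hx) (toB hy) lt i j n) v) (p , q)
        ... | inj₁ refl = contradiction v∈ (offA (∈-fromListˢ⁻ hx))
        ... | inj₂ refl = contradiction v∈ (offA (∈-fromListˢ⁻ hy))
        clear : ∃ λ is → is ⊑ allFin k₁ × length (allFin k₁) ≤ length is + length A ×
          (∀ {i v} → i ∈ is → v ∈ A → ¬ OnPath v (path i))
        clear = unhit (λ i v → any? λ l → vx (path i) l ≟ v) (UniqueP.allFin⁺ k₁) A (λ _ _ → one)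
        enough : K ≤ length (proj₁ clear)
        enough = +-cancelʳ-≤ (c * (K * K)) K _ (≤-trans le (≤-trans (≤-reflexive (sym (length-tabulate {n = k₁} (λ i → i))))
          (≤-trans (proj₁ (proj₂ (proj₂ clear))) (+-monoʳ-≤ (length (proj₁ clear)) A-len))))
        chosen = select K (AllPairs-resp-⊑ (proj₁ (proj₂ clear)) (UniqueP.allFin⁺ k₁)) enough
        pick : Fin K → Fin k₁
        pick = proj₁ chosen
        pick-inj : ∀ i j → pick i ≡ pick j → i ≡ j
        pick-inj = proj₂ (proj₂ chosen)
        avoids : ∀ i {v} → OnPath v (path (pick i)) → v Sub.∈ ∁ (fromListˢ A)
        avoids i p = x∉p⇒x∈∁p λ v∈ → proj₂ (proj₂ (proj₂ clear)) (proj₁ (proj₂ chosen) i) (∈-fromListˢ⁻ v∈) p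
      coll' : ∀ x y → x Sub.∈ fromListˢ ys → y Sub.∈ fromListˢ ys → toℕ x < toℕ y → Fin K →
        IPath G (∁ (fromListˢ A)) x y
      coll' x y hx hy lt i = restrict (path hx hy lt (pick hx hy lt i)) (avoids hx hy lt i)

-- Star forests

-- The patterns are pairs of positions below `l`; two blocks of size `biBound t` give the two sides
-- of a biclique.
legBound : ℕ → ℕ → ℕ → ℕ
legBound t δ l = avoidBound 2 (2 * biBound t) δ (length (cartesianProduct (upTo l) (upTo l)))

module Bundles (G : Graph) (t : ℕ) (clean : Clean t G) (U : Subset (n G)) where
  open Walks G
  open Bicliques G t clean

  record Bundle (K : ℕ) (x y : Vx) : Set where
    field
      Q    : Fin K → IPath G U x y
      disj : ∀ {i j v} → i ≢ j → v ∈ (x ∷ vertices (Q i)) → v ∈ (x ∷ vertices (Q j)) → v ≡ x ⊎ v ≡ y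

  module Legs {K : ℕ} {x y : Vx} (bundle : Bundle K x y) (l : ℕ)
    (far : ¬ ShortWalk l (Sub._∈ U) x y) where
    open Bundle bundle

    ind : ∀ i → Ind x (vertices (Q i)) y
    ind i = IPath⇒Ind (Q i)

    walk : ∀ i → Walk x (vertices (Q i)) y
    walk i = Ind⇒Walk (ind i)

    inside : ∀ i {z} → z ∈ (x ∷ vertices (Q i)) → z Sub.∈ U
    inside i = ∈⇒inU (Q i)

    long : ∀ i → l < length (vertices (Q i))
    long i = ≰⇒> λ le → far (vertices (Q i) , walk i , le , inside i ∘ there)

    pos : Fin K → ℕ → Vx
    pos i a = nth x (vertices (Q i)) a

    -- Positions from 1 to `l` differ from `x` and, the path being longer than `l`, from `y`; an
    -- internal vertex lies on one path only.
    pos-own : ∀ {i j a b} → a < l → b < l → pos i (suc a) ≡ pos j (suc b) → i ≡ j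
    pos-own {i} {j} {a} {b} a< b< e with i ≟ j
    ... | yes q = q
    ... | no n with disj n (nth-∈ x (vertices (Q i)) (suc a)) (subst (_∈ _) (sym e) (nth-∈ x (vertices (Q j)) (suc b)))
    ... | inj₁ q with Ind-inj (ind i) {suc a} {0} (≤-trans a< (<⇒≤ (long i))) z≤n q
    ...   | ()
    pos-own {i} {j} {a} {b} a< b< e | no n | inj₂ q = contradiction
      (Ind-inj (ind i) (≤-trans a< (<⇒≤ (long i))) ≤-refl (trans q (sym (nth-end (walk i)))))
      (<⇒≢ (≤-trans (s≤s a<) (long i)))

    reach : ∀ i {a} → a ≤ l → ShortWalk l (Sub._∈ U) x (pos i a)
    reach i {a} le = take a (vertices (Q i)) , prefix (walk i) a (≤-trans le (<⇒≤ (long i))) ,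
      ≤-trans (≤-reflexive (length-take a (vertices (Q i)))) (≤-trans (m⊓n≤m a _) le) ,
      λ z∈ → inside i (there (⊑⇒∈ (take-⊆ a (vertices (Q i))) z∈))

    contact : ℕ × ℕ → Vec (Fin K) 2 → Bool
    contact (a , b) = onPair λ i j → adj G (pos i (suc a)) (pos j (suc b))

    record Star (δ : ℕ) : Set where
      field
        leg     : Fin δ → Fin K
        leg-inj : ∀ i j → leg i ≡ leg j → i ≡ j
        apart   : ∀ {i j a b} → i ≢ j → a < l → b < l → ¬ Adj G (pos (leg i) (suc a)) (pos (leg j) (suc b))

    -- If two fixed positions were in contact for all pairs of paths in list order, two consecutive
    -- blocks of paths would span a biclique. Avoiding every pair of positions leaves pairwise
    -- anticomplete legs.
    star : ∀ δ → legBound t δ l ≤ K → Star δ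
    star δ le = finish (ramseyAvoid 2 (2 * biBound t) δ (cartesianProduct (upTo l) (upTo l)) contact (allFin K)
        (≤-trans le (≤-reflexive (sym (length-tabulate {n = K} (λ i → i)))))
        (λ {τ} {ys} τ∈ s le → bad τ∈ s (blocks 2 (biBound t) ys le)))
      where
        bad : ∀ {τ ys} → τ ∈ cartesianProduct (upTo l) (upTo l) → ys ⊑ allFin K → Blocks (Fin K) 2 (biBound t) ys →
          ¬ Hom 2 (contact τ) true ys
        bad {a , b} τ∈ s bl hom with ∈-cartesianProduct⁻ (upTo l) (upTo l) τ∈
        ... | a∈ , b∈ = biclique-free {X = λ i → pos i (suc a)} {Y = λ j → pos j (suc b)}
          (unique zero) (unique (suc zero))
          (λ _ _ → pos-own (∈-upTo⁻ a∈) (∈-upTo⁻ a∈)) (λ _ _ → pos-own (∈-upTo⁻ b∈) (∈-upTo⁻ b∈))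
          (block-len zero) (block-len (suc zero))
          (λ {i} {j} i∈ j∈ → Equivalence.from T-≡ (hom (i ∷ j ∷ []) (transversal (i ∷ j ∷ []) λ { zero → i∈ ; (suc zero) → j∈ })))
          where
            open Blocks bl
            unique : ∀ c → Unique (block c)
            unique c = AllPairs-resp-⊑ (⊑-trans (block-⊑ c) s) (UniqueP.allFin⁺ K)
        finish : (∃ λ ys → ys ⊑ allFin K × δ ≤ length ys ×
          (∀ {τ} → τ ∈ cartesianProduct (upTo l) (upTo l) → Hom 2 (contact τ) false ys)) → Star δ
        finish (ys , s , len , hom) = record
          { leg = proj₁ sel ; leg-inj = proj₂ (proj₂ sel)
          ; apart = λ {i} {j} n → no-contact (proj₁ (proj₂ sel) i) (proj₁ (proj₂ sel) j) (n ∘ proj₂ (proj₂ sel) i j) }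
          where
            sel = select δ (AllPairs-resp-⊑ s (UniqueP.allFin⁺ K)) len
            no-contact : ∀ {i j a b} → i ∈ ys → j ∈ ys → i ≢ j → a < l → b < l → ¬ Adj G (pos i (suc a)) (pos j (suc b))
            no-contact i∈ j∈ n a< b< ad with pair-⊑ i∈ j∈ n
            ... | inj₁ s' = false⇒¬T (hom (∈-cartesianProduct⁺ (∈-upTo⁺ a<) (∈-upTo⁺ b<)) _ s') ad
            ... | inj₂ s' = false⇒¬T (hom (∈-cartesianProduct⁺ (∈-upTo⁺ b<) (∈-upTo⁺ a<)) _ s') (Adj-sym ad)

  -- All bundles lead to the same `y`, but the legs stop before it. A contact between two stars
  -- would give a walk leg, edge, leg of length at most `l + (1 + l)` between their roots.
  module Forest {K θ δ l : ℕ} {y : Vx} (root : Fin θ → Vx)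
    (bundle : ∀ c → Bundle K (root c) y) (far : ∀ c → ¬ ShortWalk l (Sub._∈ U) (root c) y)
    (root-U : ∀ c → root c Sub.∈ U)
    (scattered : ∀ {c c'} → c ≢ c' → ¬ ShortWalk (l + (1 + l)) (Sub._∈ U) (root c) (root c'))
    (stars : ∀ c → Legs.Star (bundle c) l (far c) δ) where

    module L c = Legs (bundle c) l (far c)
    module S c = L.Star c (stars c)

    place : Fin θ → StarV δ l → Vx
    place c nothing = root c
    place c (just (a , j)) = L.pos c (S.leg c a) (suc (toℕ j))

    reach : ∀ c s → ShortWalk l (Sub._∈ U) (root c) (place c s)
    reach c nothing = [] , [] , z≤n , λ ()
    reach c (just (a , j)) = L.reach c (S.leg c a) (toℕ<n j)

    inside : ∀ c s → place c s Sub.∈ U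
    inside c nothing = root-U c
    inside c (just (a , j)) = L.inside c (S.leg c a) (nth-∈ (root c) _ (suc (toℕ j)))

    no-edge : ∀ {c c'} s s' → c ≢ c' → ¬ Adj G (place c s) (place c' s')
    no-edge {c} {c'} s s' n a = scattered n (ShortWalk-trans (reach c s)
      (ShortWalk-trans (ShortWalk-edge a (inside c' s')) (ShortWalk-sym (root-U c') (reach c' s'))))

    no-overlap : ∀ {c c'} s s' → c ≢ c' → place c s ≢ place c' s'
    no-overlap {c} {c'} s s' n e = scattered n (ShortWalk-≤ (+-monoʳ-≤ l (n≤1+n l)) (ShortWalk-trans (reach c s)
      (subst (λ z → ShortWalk l (Sub._∈ U) z (root c')) (sym e) (ShortWalk-sym (root-U c') (reach c' s')))))

    leg≤ : ∀ c a (j : Fin l) → suc (toℕ j) ≤ length (vertices (Bundle.Q (bundle c) (S.leg c a)))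
    leg≤ c a j = ≤-trans (toℕ<n j) (<⇒≤ (L.long c (S.leg c a)))

    place-inj : ∀ c s s' → place c s ≡ place c s' → s ≡ s'
    place-inj c nothing nothing e = refl
    place-inj c nothing (just (a , j)) e with Ind-inj (L.ind c (S.leg c a)) {0} {suc (toℕ j)} z≤n (leg≤ c a j) e
    ... | ()
    place-inj c (just (a , j)) nothing e with Ind-inj (L.ind c (S.leg c a)) {suc (toℕ j)} {0} (leg≤ c a j) z≤n e
    ... | ()
    place-inj c (just (a , j)) (just (a' , j')) e with S.leg-inj c a a' (L.pos-own c (toℕ<n j) (toℕ<n j') e)
    ... | refl with toℕ-injective (suc-injective (Ind-inj (L.ind c (S.leg c a)) (leg≤ c a j) (leg≤ c a j') e))
    ... | refl = refl

    Near-0 : ∀ {j} → Near 0 (suc j) → j ≡ 0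
    Near-0 (inj₁ e) = sym (suc-injective e)

    from-root : ∀ c a j → Adj G (root c) (place c (just (a , j))) ⇔ Near 0 (suc (toℕ j))
    from-root c a j = Ind-adjIff (L.ind c (S.leg c a)) z≤n (leg≤ c a j)

    along : ∀ c a j j' → Adj G (place c (just (a , j))) (place c (just (a , j'))) ⇔ Near (suc (toℕ j)) (suc (toℕ j'))
    along c a j j' = Ind-adjIff (L.ind c (S.leg c a)) (leg≤ c a j) (leg≤ c a j')

    star⇒adj : ∀ c s s' → starAdj s s' → Adj G (place c s) (place c s')
    star⇒adj c nothing (just (a , j)) e = Equivalence.from (from-root c a j) (inj₁ (cong suc (sym e)))
    star⇒adj c (just (a , j)) nothing e = Adj-sym (Equivalence.from (from-root c a j) (inj₁ (cong suc (sym e))))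
    star⇒adj c (just (a , j)) (just (.a , j')) (refl , e) = Equivalence.from (along c a j j') (Near-suc e)

    adj⇒star : ∀ c s s' → Adj G (place c s) (place c s') → starAdj s s'
    adj⇒star c nothing nothing ad = Adj-irrefl ad refl
    adj⇒star c nothing (just (a , j)) ad = Near-0 (Equivalence.to (from-root c a j) ad)
    adj⇒star c (just (a , j)) nothing ad = Near-0 (Equivalence.to (from-root c a j) (Adj-sym ad))
    adj⇒star c (just (a , j)) (just (a' , j')) ad = cases (a ≟ a') ad
      where
        cases : Dec (a ≡ a') → Adj G (place c (just (a , j))) (place c (just (a' , j'))) → starAdj (just (a , j)) (just (a' , j'))
        cases (yes refl) ad = refl , Near-pred (Equivalence.to (along c a j j') ad)
        cases (no n) ad = contradiction ad (S.apart c n (toℕ<n j) (toℕ<n j'))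

    forest : InducedCopy G U (starForest θ δ l)
    forest = record
      { emb = λ { (c , s) → place c s }
      ; inj = λ { (c , s) (c' , s') e → inj' c s c' s' (c ≟ c') e }
      ; inU = λ { (c , s) → inside c s }
      ; adjIff = λ { (c , s) (c' , s') → mk⇔ (to c s c' s') (from c s c' s' (c ≟ c')) }
      }
      where
        inj' : ∀ c s c' s' → Dec (c ≡ c') → place c s ≡ place c' s' → (c , s) ≡ (c' , s')
        inj' c s .c s' (yes refl) e = cong (c ,_) (place-inj c s s' e)
        inj' c s c' s' (no n) e = contradiction e (no-overlap s s' n)
        to : ∀ c s c' s' → (c ≡ c') × starAdj s s' → Adj G (place c s) (place c' s')
        to c s .c s' (refl , e) = star⇒adj c s s' e
        from : ∀ c s c' s' → Dec (c ≡ c') → Adj G (place c s) (place c' s') → (c ≡ c') × starAdj s s'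
        from c s .c s' (yes refl) ad = refl , adj⇒star c s s' ad
        from c s c' s' (no n) ad = contradiction ad (no-edge s s' n)

-- Long holes

abstract
  -- For spokes of length 0 two distinct ends are absurd. Otherwise Ramsey's theorem gives `M`
  -- disjoint spokes, or a spoke with at most `suc D` vertices that meets all later ones, so that
  -- `fanBound D M` of these share a vertex.
  fanBound : ℕ → ℕ → ℕ
  fanBound zero M = 2
  fanBound (suc D) M = ramseyBound 2 (M ⊔ suc (suc (suc D * fanBound D M)))

  fanBound-zero : ∀ {M} → 2 ≤ fanBound 0 M
  fanBound-zero = ≤-refl

  fanBound-suc : ∀ {D M m} → fanBound (suc D) M ≤ m → ramseyBound 2 (M ⊔ suc (suc (suc D * fanBound D M))) ≤ m
  fanBound-suc le = le

module Fans (G : Graph) where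
  open Walks G

  after : Vx → List Vx → List Vx
  after u [] = []
  after u (z ∷ zs) with z ≟ u
  ... | yes _ = zs
  ... | no _ = after u zs

  after-walk : ∀ {u v ps e} → Walk v ps e → u ∈ ps → Walk u (after u ps) e × length (after u ps) < length ps
  after-walk {u} {ps = z ∷ zs} (a ∷ w) u∈ with z ≟ u
  after-walk (a ∷ w) u∈ | yes refl = w , ≤-refl
  after-walk (a ∷ w) (here e) | no n = contradiction (sym e) n
  after-walk (a ∷ w) (there u∈) | no n with after-walk w u∈
  ... | w' , le = w' , ≤-trans le (n≤1+n _)

  after-⊆ : ∀ u ps {z} → z ∈ after u ps → z ∈ ps
  after-⊆ u (x ∷ ps) q with x ≟ u
  ... | yes _ = there q
  ... | no _ = there (after-⊆ u ps q)

  module _ {K : ℕ} (e : Fin K → Vx) where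

    Spokes : ℕ → Vx → List (Fin K) → (Fin K → List Vx) → Set
    Spokes D v I p = ∀ {i} → i ∈ I → Walk v (p i) (e i) × length (p i) ≤ D

    -- `sub` and `hub-on` keep the hub and the spokes among the old vertices, so these still avoid
    -- what the original walks avoided.
    record Fan (D M : ℕ) (v : Vx) (I : List (Fin K)) (p : Fin K → List Vx) : Set where
      field
        hub    : Vx
        J      : List (Fin K)
        p'     : Fin K → List Vx
        J⊑     : J ⊑ I
        size   : M ≤ length J
        spokes : Spokes D hub J p'
        sub    : ∀ {i z} → i ∈ J → z ∈ p' i → z ∈ p i
        disj   : ∀ {i j z} → i ∈ J → j ∈ J → z ∈ p' i → z ∈ p' j → i ≡ j
        hub-on : hub ≡ v ⊎ ∃ λ i → i ∈ I × hub ∈ p i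

    Meet : (Fin K → List Vx) → Fin K → Fin K → Set
    Meet p i j = Any (_∈ p j) (p i)

    meet? : ∀ p i j → Dec (Meet p i j)
    meet? p i j = Any.any? (_∈? p j) (p i)

    disjoint : (Fin K → List Vx) → Vec (Fin K) 2 → Bool
    disjoint p = onPair λ i j → does (¬? (meet? p i j))

    -- If the spokes pairwise meet, many pass through one vertex of the first; continue from there.
    fan : ∀ D M {v I p} → Unique I → InjOn e I → Spokes D v I p → fanBound D M ≤ length I → Fan D M v I p
    fan zero M {I = []} u inj sp le with ≤-trans fanBound-zero le
    ... | ()
    fan zero M {I = i ∷ []} u inj sp le with ≤-trans fanBound-zero le
    ... | s≤s ()
    fan zero M {I = i ∷ j ∷ I} ((i≢j ∷ _) ∷ _) inj sp le = contradiction
        (inj (here refl) (there (here refl)) (trans (sym (at-start (sp (here refl)))) (at-start (sp (there (here refl)))))) i≢j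
      where
        at-start : ∀ {v ps w} → Walk v ps w × length ps ≤ 0 → v ≡ w
        at-start ([] , _) = refl
    fan (suc D) M {v} {I} {p} uniq inj sp le = finish (ramsey 2 (M ⊔ suc (suc (suc D * fanBound D M))) (disjoint p) I (fanBound-suc le))
      where
        grow : ∀ {u J} → J ⊑ I → (∃ λ i → i ∈ I × u ∈ p i) → Fan D M u J (after u ∘ p) → Fan (suc D) M v I p
        grow {u} {J} s (i , i∈ , u∈) f = record
          { hub = hub ; J = F.J ; p' = p' ; J⊑ = ⊑-trans J⊑ s ; size = size
          ; spokes = λ q → proj₁ (spokes q) , ≤-trans (proj₂ (spokes q)) (n≤1+n D)
          ; sub = λ {i} q z → after-⊆ u (p i) (sub q z)
          ; disj = disj
          ; hub-on = inj₂ (on hub-on) }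
          where
            module F = Fan f
            open Fan f hiding (J)
            on : hub ≡ u ⊎ (∃ λ i → i ∈ J × hub ∈ after u (p i)) → ∃ λ i → i ∈ I × hub ∈ p i
            on (inj₁ q) = i , i∈ , subst (_∈ p i) (sym q) u∈
            on (inj₂ (j , j∈ , h)) = j , ⊑⇒∈ s j∈ , after-⊆ u (p j) h
        split : ∀ {i js} → (i ∷ js) ⊑ I → suc (suc (suc D * fanBound D M)) ≤ suc (length js) →
          (∀ {j} → j ∈ js → Meet p i j) → Fan (suc D) M v I p
        split {i} {js} s le meets = go (pigeonhole {H = λ j z → z ∈ p j} (λ j z → z ∈? p j) (fanBound D M) js (p i)
            (λ j∈ → find (meets j∈))
            (≤-trans (s≤s (*-monoˡ-≤ (fanBound D M) (proj₂ (sp (⊑⇒∈ s (here refl)))))) (s≤s⁻¹ le)))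
          where
            go : (∃ λ u → u ∈ p i × ∃ λ J → J ⊑ js × fanBound D M ≤ length J × (∀ {j} → j ∈ J → u ∈ p j)) → Fan (suc D) M v I p
            go (u , u∈ , J , J⊑ , len , on) = grow s' (i , ⊑⇒∈ s (here refl) , u∈)
              (fan D M (AllPairs-resp-⊑ s' uniq) (λ p q → inj (⊑⇒∈ s' p) (⊑⇒∈ s' q))
                -- Restarting at `u` loses at least one step of each walk, so the length bound drops
                -- to `D`.
                (λ j∈ → let (w , l) = after-walk (proj₁ (sp (⊑⇒∈ s' j∈))) (on j∈) in w , s≤s⁻¹ (≤-trans l (proj₂ (sp (⊑⇒∈ s' j∈))))) len)
              where
                s' : J ⊑ I
                s' = ⊑-trans J⊑ (⊑-trans (i ∷ʳ ⊑-refl) s)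
        finish : (∃ λ ys → ys ⊑ I × M ⊔ suc (suc (suc D * fanBound D M)) ≤ length ys × ∃ λ b → Hom 2 (disjoint p) b ys) →
          Fan (suc D) M v I p
        finish (ys , s , len , true , hom) = record
          { hub = v ; J = ys ; p' = p ; J⊑ = s ; size = ≤-trans (m≤m⊔n M _) len
          ; spokes = λ q → sp (⊑⇒∈ s q) ; sub = λ _ z → z
          ; disj = disj ; hub-on = inj₁ refl }
          where
            disj : ∀ {i j z} → i ∈ ys → j ∈ ys → z ∈ p i → z ∈ p j → i ≡ j
            disj {i} {j} i∈ j∈ z∈ z∈' with i ≟ j
            ... | yes q = q
            ... | no n with pair-⊑ i∈ j∈ n
            ... | inj₁ s' = contradiction (lose z∈ z∈') (does-true (¬? (meet? p i j)) (hom (i ∷ j ∷ []) s'))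
            ... | inj₂ s' = contradiction (lose z∈' z∈) (does-true (¬? (meet? p j i)) (hom (j ∷ i ∷ []) s'))
        finish ([] , s , len , false , hom) with ≤-trans (m≤n⊔m M _) len
        ... | ()
        finish (i ∷ js , s , len , false , hom) = split s (≤-trans (m≤n⊔m M _) len)
          λ {j} j∈ → decidable-stable (meet? p i j) (does-false (¬? (meet? p i j)) (hom (i ∷ j ∷ []) (refl ∷ from∈ j∈)))

  two-edges : ∀ {a qs b} → Ind a qs b → a ≢ b → ¬ Adj G a b → 2 ≤ length qs
  two-edges [] a≢b _ = contradiction refl a≢b
  two-edges (ext ab _ []) _ ¬ab = contradiction ab ¬ab
  two-edges (ext _ _ (ext _ _ _)) _ _ = s≤s (s≤s z≤n)

  -- Beyond `a`, the path meets the neighbourhood of `x` only in `b`, so `x` closes it to an induced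
  -- cycle; as `a` and `b` are not adjacent, its length is at least four.
  module Closing {U : Subset (n G)} {x a b : Vx} {qs : List Vx} (p : Ind a qs b) (xa : Adj G x a) (xb : Adj G x b)
    (a≢b : a ≢ b) (¬ab : ¬ Adj G a b) (only-b : ∀ {z} → z ∈ qs → Adj G x z → z ≡ b) (x∉ : x ∉ qs)
    (x∈U : x Sub.∈ U) (inside : ∀ {z} → z ∈ (a ∷ qs) → z Sub.∈ U) where

    size : ℕ
    size = suc (suc (length qs))

    cyc' : Fin size → Vx
    cyc' zero = x
    cyc' (suc i) = nth a qs (toℕ i)

    bound : (i : Fin (suc (length qs))) → toℕ i ≤ length qs
    bound i = s≤s⁻¹ (toℕ<n i)

    x∉' : (i : Fin (suc (length qs))) → x ≢ nth a qs (toℕ i)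
    x∉' i e with subst (_∈ (a ∷ qs)) (sym e) (nth-∈ a qs (toℕ i))
    ... | here q = Adj-irrefl xa q
    ... | there q = x∉ q

    cyc-inj : ∀ i j → cyc' i ≡ cyc' j → i ≡ j
    cyc-inj zero zero _ = refl
    cyc-inj zero (suc j) e = contradiction e (x∉' j)
    cyc-inj (suc i) zero e = contradiction (sym e) (x∉' i)
    cyc-inj (suc i) (suc j) e = cong suc (toℕ-injective (Ind-inj p (bound i) (bound j) e))

    from-x : ∀ j → Adj G x (nth a qs (toℕ j)) → CycNext {size} zero (suc j) ⊎ CycNext {size} (suc j) zero
    from-x zero _ = inj₁ (inj₁ refl)
    from-x (suc j) ad = inj₂ (inj₂ (cong (λ m → ℕ.suc (ℕ.suc m)) (Ind-inj p (bound (suc j)) ≤-refl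
      (trans (only-b (nth-∈-tail a qs (bound (suc j))) ad) (sym (nth-end (Ind⇒Walk p))))) , refl))

    to-x : ∀ j → CycNext {size} zero (suc j) ⊎ CycNext {size} (suc j) zero → Adj G x (nth a qs (toℕ j))
    to-x j (inj₁ (inj₁ e)) = subst (λ k → Adj G x (nth a qs k)) (suc-injective e) xa
    to-x j (inj₁ (inj₂ (_ , ())))
    to-x j (inj₂ (inj₁ ()))
    to-x j (inj₂ (inj₂ (e , _))) = subst (Adj G x) (sym (trans (cong (nth a qs) (suc-injective (suc-injective e))) (nth-end (Ind⇒Walk p)))) xb

    no-loop : CycNext {size} zero zero → ⊥
    no-loop (inj₁ ())
    no-loop (inj₂ (() , _))

    cyc-adj : ∀ i j → Adj G (cyc' i) (cyc' j) ⇔ (CycNext {size} i j ⊎ CycNext {size} j i)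
    cyc-adj zero zero = mk⇔ (λ ad → contradiction refl (Adj-irrefl ad)) (λ h → ⊥-elim ([ no-loop , no-loop ]′ h))
    cyc-adj zero (suc j) = mk⇔ (from-x j) (to-x j)
    cyc-adj (suc i) zero = mk⇔ (swap ∘ from-x i ∘ Adj-sym) (Adj-sym ∘ to-x i ∘ swap)
    cyc-adj (suc i) (suc j) = mk⇔
      ([ (λ e → inj₁ (inj₁ (cong suc e))) , (λ e → inj₂ (inj₁ (cong suc e))) ]′ ∘ Equivalence.to iff)
      (Equivalence.from iff ∘ λ { (inj₁ (inj₁ e)) → inj₁ (suc-injective e) ; (inj₂ (inj₁ e)) → inj₂ (suc-injective e)
                                ; (inj₁ (inj₂ (_ , ()))) ; (inj₂ (inj₂ (_ , ()))) })
      where iff = Ind-adjIff p (bound i) (bound j)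

    hole : Hole G U
    hole = record
      { L = size ; four = s≤s (s≤s (two-edges p a≢b ¬ab)) ; cyc = cyc' ; inj = cyc-inj
      ; inU = λ { zero → x∈U ; (suc i) → inside (nth-∈ a qs (toℕ i)) }
      ; adjIff = cyc-adj }

  first-step : ∀ {x ps y} → Ind x ps y → 0 < length ps →
    Adj G x (nth x ps 1) × Walk (nth x ps 1) (drop 1 ps) y × (∀ {z} → z ∈ drop 1 ps → ¬ (Adj G x z ⊎ x ≡ z))
  first-step (ext a f p) _ = a , Ind⇒Walk p , All.lookup f

  first-step-∈ : ∀ (x : Vx) {ps z} → 0 < length ps → z ∈ (nth x ps 1 ∷ drop 1 ps) → z ∈ ps
  first-step-∈ x {_ ∷ _} _ q = q

-- Each round spends the index from which connections start and at most one index whose path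
-- contains the new hub.
hubsBound : ℕ → ℕ → ℕ → ℕ
hubsBound l zero M = M
hubsBound l (suc h) M = suc (fanBound l (suc (hubsBound l h M)))

-- Enough hubs to contradict the key fact for walks of length `l + l`, with 2c + 1 common ends,
-- where c is `keyConn t (l + l)`.
holeBound : ℕ → ℕ → ℕ
holeBound t l = avoidBound 2 t (hubsBound l (keySize t (l + l)) (suc (keyConn t (l + l) + keyConn t (l + l)))) 1

-- Besides making the paths long, `far` rules out `y` as a hub: a hub reaches some `a i` within `l`
-- steps and then `x` in one more.
module LongHole (G : Graph) (t : ℕ) (clean : Clean t G) (U : Subset (n G)) (l : ℕ) (1≤l : 1 ≤ l)
  {K : ℕ} {x y : Fin (n G)} (bundle : Bundles.Bundle G t clean U K x y)
  (far : ¬ Walks.ShortWalk G (l + 1) (Sub._∈ U) y x) (x∈U : x Sub.∈ U) where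
  open Walks G
  open Bicliques G t clean
  open Bundles G t clean U
  open Fans G
  open Key G t clean (l + l)
  open Bundle bundle
  open Legs bundle l (far ∘ ShortWalk-≤ (m≤m+n l 1) ∘ ShortWalk-sym x∈U)

  Goal : Set
  Goal = Σ (Hole G U) λ H → l < Hole.L H

  a : Fin K → Vx
  a i = pos i 1

  rest : Fin K → List Vx
  rest i = drop 1 (vertices (Q i))

  nonempty : ∀ i → 0 < length (vertices (Q i))
  nonempty i = ≤-trans (s≤s z≤n) (long i)

  xa : ∀ i → Adj G x (a i)
  xa i = proj₁ (first-step (ind i) (nonempty i))

  rest-walk : ∀ i → Walk (a i) (rest i) y
  rest-walk i = proj₁ (proj₂ (first-step (ind i) (nonempty i)))

  rest-far : ∀ i {z} → z ∈ rest i → ¬ (Adj G x z ⊎ x ≡ z)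
  rest-far i = proj₂ (proj₂ (first-step (ind i) (nonempty i)))

  a-inj : ∀ {i j} → a i ≡ a j → i ≡ j
  a-inj = pos-own 1≤l 1≤l

  on-Q : ∀ i {z} → z ∈ (a i ∷ rest i) → z ∈ vertices (Q i)
  on-Q i = first-step-∈ x (nonempty i)

  a∈Q : ∀ i → a i ∈ vertices (Q i)
  a∈Q i = on-Q i (here refl)

  Avoids : List Vx → Fin K → Set
  Avoids F i = ∀ {z} → z ∈ vertices (Q i) → z ∉ F

  Connection : List Vx → Fin K → Fin K → List Vx → Set
  Connection F i j qs = Walk (a i) qs (a j) × length qs ≤ l × (∀ {z} → z ∈ qs → z Sub.∈ U × z ∉ F)

  -- Go from `a i` along its path to `y` and back to `a j`. After `a i` only `a j` is adjacent to
  -- `x`, so an induced path inside this walk closes through `x` to a hole, which is long unless the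
  -- path has fewer than `l` edges.
  connect : ∀ {F i j} → Avoids F i → Avoids F j → i ≢ j → ¬ Adj G (a i) (a j) →
    Goal ⊎ ∃ (Connection F i j)
  connect {F} {i} {j} avi avj i≢j ¬ad = decide (l ≤? length qs)
    where
      back = reverseWalk (rest-walk j)
      path = shortcut (rest-walk i +++ proj₁ (proj₂ back))
      qs = proj₁ path
      p : Ind (a i) qs (a j)
      p = proj₁ (proj₂ path)
      where-is : ∀ {z} → z ∈ qs → z ∈ rest i ⊎ z ∈ (a j ∷ rest j)
      where-is q with ∈-++⁻ (rest i) (proj₂ (proj₂ (proj₂ path)) q)
      ... | inj₁ h = inj₁ h
      ... | inj₂ h = inj₂ (proj₂ (proj₂ (proj₂ back)) h)
      only : ∀ {z} → z ∈ qs → Adj G x z → z ≡ a j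
      only q ad with where-is q
      ... | inj₁ h = contradiction (inj₁ ad) (rest-far i h)
      ... | inj₂ (here e) = e
      ... | inj₂ (there h) = contradiction (inj₁ ad) (rest-far j h)
      x∉ : x ∉ qs
      x∉ q with where-is q
      ... | inj₁ h = rest-far i h (inj₂ refl)
      ... | inj₂ (here e) = Adj-irrefl (xa j) e
      ... | inj₂ (there h) = rest-far j h (inj₂ refl)
      onQ : ∀ {z} → z ∈ qs → z ∈ vertices (Q i) ⊎ z ∈ vertices (Q j)
      onQ q with where-is q
      ... | inj₁ h = inj₁ (on-Q i (there h))
      ... | inj₂ h = inj₂ (on-Q j h)
      inside' : ∀ {z} → z ∈ qs → z Sub.∈ U
      inside' q = [ inside i ∘ there , inside j ∘ there ]′ (onQ q)
      inside'' : ∀ {z} → z ∈ (a i ∷ qs) → z Sub.∈ U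
      inside'' (here refl) = inside i (there (a∈Q i))
      inside'' (there q) = inside' q
      module C = Closing p (xa i) (xa j) (i≢j ∘ a-inj) ¬ad only x∉ x∈U inside''
      decide : Dec (l ≤ length qs) → Goal ⊎ ∃ (Connection F i j)
      -- The hole has two more vertices than the path has edges.
      decide (yes le) = inj₁ (C.hole , s≤s (≤-trans le (n≤1+n _)))
      decide (no nle) = inj₂ (qs , Ind⇒Walk p , <⇒≤ (≰⇒> nle) ,
        λ q → inside' q , [ avi , avj ]′ (onQ q))

  record Hub (w : Vx) (I : List (Fin K)) : Set where
    field
      spoke  : Fin K → List Vx
      spokes : Spokes a l w I spoke
      disj   : ∀ {i j z} → i ∈ I → j ∈ I → z ∈ spoke i → z ∈ spoke j → i ≡ j

  Hub-⊑ : ∀ {w I J} → J ⊑ I → Hub w I → Hub w J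
  Hub-⊑ s h = record
    { spoke = H.spoke ; spokes = λ q → H.spokes (⊑⇒∈ s q) ; disj = λ p q → H.disj (⊑⇒∈ s p) (⊑⇒∈ s q) }
    where module H = Hub h

  record Good (F : List Vx) (I : List (Fin K)) : Set where
    field
      unique : Unique I
      stable : ∀ {i j} → i ∈ I → j ∈ I → ¬ Adj G (a i) (a j)
      avoids : ∀ {i} → i ∈ I → Avoids F i

  record Step (F : List Vx) (I : List (Fin K)) (M : ℕ) : Set where
    field
      w     : Vx
      w∉    : w ∉ F
      J     : List (Fin K)
      J⊑    : J ⊑ I
      size  : M ≤ length J
      hub   : Hub w J
      avoid : ∀ {i} → i ∈ J → w ∉ vertices (Q i)

  -- Without a long hole, `i₀` has short connections to all other indices, and these contain a fan.
  -- Its hub lies on at most one path of the bundle; dropping that index lets later connections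
  -- avoid the hub.
  hub-step : ∀ {F I} M → Good F I → suc (fanBound l (suc M)) ≤ length I → Goal ⊎ Step F I M
  hub-step {F} {i₀ ∷ I} M good (s≤s le) = joined (traverse I λ {j} j∈ →
      connect (avoids (here refl)) (avoids (there j∈)) (All.lookup (i₀∉ unique) j∈) (stable (here refl) (there j∈)))
    where
      open Good good
      i₀∉ : Unique (i₀ ∷ I) → All (i₀ ≢_) I
      i₀∉ (h ∷ _) = h
      tail-unique : Unique (i₀ ∷ I) → Unique I
      tail-unique (_ ∷ u) = u
      found : (p : Fin K → List Vx) → (∀ {j} → j ∈ I → Connection F i₀ j (p j)) → Fan a l (suc M) (a i₀) I p → Step F (i₀ ∷ I) M
      found p conn f = record
        { w = Φ.hub ; w∉ = hub∉ Φ.hub-on ; J = proj₁ kept ; J⊑ = i₀ ∷ʳ ⊑-trans kept⊑ Φ.J⊑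
        ; size = s≤s⁻¹ (≤-trans Φ.size (≤-trans (proj₁ (proj₂ (proj₂ kept))) (≤-reflexive (+-comm (length (proj₁ kept)) 1))))
        ; hub = Hub-⊑ kept⊑ (record { spoke = Φ.p' ; spokes = Φ.spokes ; disj = Φ.disj })
        ; avoid = λ i∈ q → proj₂ (proj₂ (proj₂ kept)) i∈ (here refl) q }
        where
          module Φ = Fan f
          hub∉ : Φ.hub ≡ a i₀ ⊎ (∃ λ i → i ∈ I × Φ.hub ∈ p i) → Φ.hub ∉ F
          hub∉ (inj₁ e) = subst (_∉ F) (sym e) (avoids (here refl) (a∈Q i₀))
          hub∉ (inj₂ (i , i∈ , q)) = proj₂ (proj₂ (proj₂ (conn i∈)) q)
          member : ∀ {J} → suc M ≤ length J → ∃ (_∈ J)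
          member {i ∷ _} _ = i , here refl
          i = proj₁ (member {Φ.J} Φ.size)
          i∈ = proj₂ (member {Φ.J} Φ.size)
          to-x : ShortWalk (l + 1) (Sub._∈ U) Φ.hub x
          to-x = ShortWalk-trans
            (Φ.p' i , proj₁ (Φ.spokes i∈) , proj₂ (Φ.spokes i∈) , λ q → proj₁ (proj₂ (proj₂ (conn (⊑⇒∈ Φ.J⊑ i∈))) (Φ.sub i∈ q)))
            (ShortWalk-edge (Adj-sym (xa i)) x∈U)
          hub≢y : Φ.hub ≢ y
          hub≢y e = far (subst (λ z → ShortWalk (l + 1) (Sub._∈ U) z x) e to-x)
          hub≢x : ∀ {i} → Φ.hub ∈ vertices (Q i) → Φ.hub ≢ x
          hub≢x {i} q e = Ind-start∉ (ind i) (subst (_∈ vertices (Q i)) e q)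
          one : ∀ {i j z} → z ∈ (Φ.hub ∷ []) → z ∈ vertices (Q i) → z ∈ vertices (Q j) → i ≡ j
          one {i} {j} (here refl) q q' with i ≟ j
          ... | yes e = e
          ... | no n with Bundle.disj bundle n (there q) (there q')
          ... | inj₁ e = contradiction e (hub≢x q)
          ... | inj₂ e = contradiction e hub≢y
          kept = unhit (λ i z → z ∈? vertices (Q i)) (AllPairs-resp-⊑ Φ.J⊑ (tail-unique unique)) (Φ.hub ∷ []) (λ _ _ → one)
          kept⊑ = proj₁ (proj₂ kept)
      joined : Goal ⊎ (∀ {j} → j ∈ I → ∃ (Connection F i₀ j)) → Goal ⊎ Step F (i₀ ∷ I) M
      joined (inj₁ g) = inj₁ g
      joined (inj₂ h) = inj₂ (found p conn (fan a l (suc M) (tail-unique unique) (λ _ _ → a-inj)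
          (λ j∈ → proj₁ (conn j∈) , proj₁ (proj₂ (conn j∈))) le))
        where
          chosen = choice _≟_ [] {R = Connection F i₀} I h
          p = proj₁ chosen
          conn : ∀ {j} → j ∈ I → Connection F i₀ j (p j)
          conn = proj₂ chosen

  record Hubs (F : List Vx) (I : List (Fin K)) (h M : ℕ) : Set where
    field
      W      : List Vx
      number : length W ≡ h
      unique : Unique W
      fresh  : ∀ {w} → w ∈ W → w ∉ F
      J      : List (Fin K)
      J⊑     : J ⊑ I
      size   : M ≤ length J
      hubs   : ∀ {w} → w ∈ W → Hub w J

  -- Each new hub joins the list `F` that later connections avoid, so the hubs are distinct, and all
  -- keep their spokes to the surviving indices.
  many-hubs : ∀ h M {F I} → Good F I → hubsBound l h M ≤ length I → Goal ⊎ Hubs F I h M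
  many-hubs zero M {F} {I} good le = inj₂ (record
    { W = [] ; number = refl ; unique = [] ; fresh = λ () ; J = I ; J⊑ = ⊑-refl ; size = le ; hubs = λ () })
  many-hubs (suc h) M {F} {I} good le = next (hub-step (hubsBound l h M) good le)
    where
      next : Goal ⊎ Step F I (hubsBound l h M) → Goal ⊎ Hubs F I (suc h) M
      next (inj₁ g) = inj₁ g
      next (inj₂ st) = extend (many-hubs h M good' S.size)
        where
          module S = Step st
          good' : Good (S.w ∷ F) S.J
          good' = record
            { unique = AllPairs-resp-⊑ S.J⊑ (Good.unique good)
            ; stable = λ p q → Good.stable good (⊑⇒∈ S.J⊑ p) (⊑⇒∈ S.J⊑ q)
            ; avoids = λ { i∈ q (here refl) → S.avoid i∈ q ; i∈ q (there z) → Good.avoids good (⊑⇒∈ S.J⊑ i∈) q z } }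
          extend : Goal ⊎ Hubs (S.w ∷ F) S.J h M → Goal ⊎ Hubs F I (suc h) M
          extend (inj₁ g) = inj₁ g
          extend (inj₂ hs) = inj₂ (record
            { W = S.w ∷ H.W ; number = cong suc H.number
            ; unique = All.tabulate (λ q e → H.fresh q (here (sym e))) ∷ H.unique
            ; fresh = λ { (here refl) → S.w∉ ; (there q) z → H.fresh q (there z) }
            ; J = H.J ; J⊑ = ⊑-trans H.J⊑ S.J⊑ ; size = H.size
            ; hubs = λ { (here refl) → Hub-⊑ H.J⊑ S.hub ; (there q) → H.hubs q } })
            where module H = Hubs hs

  unhit-spokes : ∀ {w J} (F : List Vx) → Unique J → (h : Hub w J) →
    ∃ λ I → I ⊑ J × length J ≤ length I + length F × (∀ {i z} → i ∈ I → z ∈ F → z ∉ Hub.spoke h i)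
  unhit-spokes F u h = unhit (λ i z → z ∈? Hub.spoke h i) u F (λ p q _ → Hub.disj h p q)

  spoke-walk : ∀ {w J i} {F : List Vx} (h : Hub w J) → i ∈ J → (∀ {z} → z ∈ F → z ∉ Hub.spoke h i) →
    ShortWalk l (_∉ F) w (a i)
  spoke-walk {i = i} h i∈ ok = Hub.spoke h i , proj₁ (Hub.spokes h i∈) , proj₂ (Hub.spokes h i∈) , λ q z → ok z q

  -- At most `c` vertices meet at most `c` of the disjoint spokes of each hub, so one of the 2c + 1
  -- common ends keeps its spokes to both.
  hubs-linked : ∀ {c w w' J} → Unique J → suc (c + c) ≤ length J → Hub w J → Hub w' J → Linked c w w'
  hubs-linked {c} {w} {w'} {J} uniq size h h' F F≤ w∉ w'∉ = common (unhit-spokes F uniq h)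
    where
      common : (∃ λ I → I ⊑ J × length J ≤ length I + length F × (∀ {i z} → i ∈ I → z ∈ F → z ∉ Hub.spoke h i)) →
        ShortWalk (l + l) (_∉ F) w w'
      common (I , s , len , ok) = both (unhit-spokes F (AllPairs-resp-⊑ s uniq) (Hub-⊑ s h'))
        where
          1+c≤ : suc c ≤ length I
          1+c≤ = +-cancelʳ-≤ c (suc c) _ (≤-trans size (≤-trans len (+-monoʳ-≤ (length I) F≤)))
          both : (∃ λ I' → I' ⊑ I × length I ≤ length I' + length F × (∀ {i z} → i ∈ I' → z ∈ F → z ∉ Hub.spoke h' i)) →
            ShortWalk (l + l) (_∉ F) w w'
          both ([] , _ , len' , _) = contradiction (≤-trans 1+c≤ (≤-trans len' F≤)) (<-irrefl refl)
          both (i ∷ _ , s' , _ , ok') = ShortWalk-trans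
            (spoke-walk h (⊑⇒∈ s (⊑⇒∈ s' (here refl))) (ok (⊑⇒∈ s' (here refl))))
            (ShortWalk-sym w'∉ (spoke-walk h' (⊑⇒∈ s (⊑⇒∈ s' (here refl))) (ok' (here refl))))

  -- The `a i` are first made pairwise non-adjacent, as closing a hole requires. Without a long hole
  -- the hubs would form a robustly linked set that is too large.
  long-hole : holeBound t l ≤ K → Goal
  long-hole le = start-hubs (stable-subset _ {X = a} (UniqueP.allFin⁺ K) (λ _ _ → a-inj)
      (≤-trans le (≤-reflexive (sym (length-tabulate {n = K} (λ i → i))))))
    where
      c = keyConn t (l + l)
      finish : ∀ {I} → Unique I → Goal ⊎ Hubs [] I (keySize t (l + l)) (suc (c + c)) → Goal
      finish _ (inj₁ g) = g
      finish u (inj₂ hs) = ⊥-elim (not-all-linked H.unique (≤-reflexive (sym H.number))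
          (λ w∈ w'∈ _ → hubs-linked (AllPairs-resp-⊑ H.J⊑ u) H.size (H.hubs w∈) (H.hubs w'∈)))
        where module H = Hubs hs
      start-hubs : (∃ λ I → I ⊑ allFin K × hubsBound l (keySize t (l + l)) (suc (c + c)) ≤ length I ×
        (∀ {i j} → i ∈ I → j ∈ I → ¬ Adj G (a i) (a j))) → Goal
      start-hubs (I , s , len , st) = finish u (many-hubs (keySize t (l + l)) (suc (c + c))
          (record { unique = u ; stable = st ; avoids = λ _ _ () }) len)
        where u = AllPairs-resp-⊑ s (UniqueP.allFin⁺ K)

-- Assembling the theorem

StrongBlock-≤ : ∀ {G U k K B} → k ≤ K → StrongBlock G U K B → StrongBlock G U k B
StrongBlock-≤ {k = k} {K} le (size , coll , within , across) = ≤-trans le size ,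
  (λ x y hx hy lt i → coll x y hx hy lt (inject≤ i le)) ,
  (λ x y hx hy lt i j n → within x y hx hy lt _ _ (n ∘ inject≤-injective le le i j)) ,
  (λ x y x' y' hx hy lt hx' hy' lt' n i j → across x y x' y' hx hy lt hx' hy' lt' n _ _)

module Assemble (d k t δ l θ : ℕ) (1≤l : 1 ≤ l) (1≤θ : 1 ≤ θ) where

  -- The bound `l + (1 + l)` keeps different stars apart and includes the distance `l + 1` needed
  -- for long holes.
  D : ℕ
  D = d ⊔ (l + (1 + l))

  -- `suc θ` vertices provide the `θ` roots and one vertex to which all their paths lead.
  K : ℕ
  K = suc θ + (k + (legBound t δ l + holeBound t l))

  Outcome : (G : Graph) → Subset (n G) → Set
  Outcome G B = Σ (Subset (n G)) λ A → Σ (Subset (n G)) λ S →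
    S ⊆ (B ─ A) × StrongBlock G (∁ A) k S × Stable G (∁ A) d S ×
    RootedStarForestIn G (∁ A) θ δ l S × Σ (Hole G (∁ A)) λ H → l < Hole.L H

  module _ (G : Graph) (clean : Clean t G) (B : Subset (n G)) where
    open Walks G
    open Bicliques G t clean
    open Separate G t clean D

    module _ {A ys : List Vx} (sc : Scattered K B A ys)
      (block : StrongBlock G (∁ (fromListˢ A)) K (fromListˢ ys)) where
      open Scattered sc
      U = ∁ (fromListˢ A)
      open Bundles G t clean U

      U⇒∉A : ∀ {z} → z Sub.∈ U → z ∉ A
      U⇒∉A z∈ q = x∈∁p⇒x∉p z∈ (∈-fromListˢ⁺ q)

      ys-U : ∀ {z} → z ∈ ys → z Sub.∈ U
      ys-U z∈ = x∉p⇒x∈∁p (offA z∈ ∘ ∈-fromListˢ⁻)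

      apart : ∀ {e u v} → e ≤ D → u ∈ ys → v ∈ ys → u ≢ v → ¬ ShortWalk e (Sub._∈ U) u v
      apart e≤ u∈ v∈ n (ps , w , le , ok) = stable u∈ v∈ n (ps , w , ≤-trans le e≤ , λ q → U⇒∉A (ok q))

      l≤D : l + (1 + l) ≤ D
      l≤D = m≤n⊔m d _

      S-stable : Stable G U d (fromListˢ ys)
      S-stable x y hx hy n (P , le) = apart (m≤m⊔n d _) (∈-fromListˢ⁻ hx) (∈-fromListˢ⁻ hy) n
        (vertices P , Ind⇒Walk (IPath⇒Ind P) , ≤-trans (≤-reflexive (length-vertices P)) le , ∈⇒inU P ∘ there)

      S-sub : fromListˢ ys ⊆ (B ─ fromListˢ A)
      S-sub h = x∈p∧x∉q⇒x∈p─q (inB (∈-fromListˢ⁻ h)) (offA (∈-fromListˢ⁻ h) ∘ ∈-fromListˢ⁻)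

      bundle : ∀ {x y} → x ∈ ys → y ∈ ys → toℕ x < toℕ y → Bundle K x y
      bundle {x} {y} x∈ y∈ lt = record
        { Q = path
        ; disj = λ {i} {j} {v} n p q → Equivalence.to
            (proj₂ (proj₁ (proj₂ (proj₂ block)) x y (∈-fromListˢ⁺ x∈) (∈-fromListˢ⁺ y∈) lt i j n) v)
            (∈⇒OnPath (path i) p , ∈⇒OnPath (path j) q) }
        where
          path : Fin K → IPath G U x y
          path = proj₁ (proj₂ block) x y (∈-fromListˢ⁺ x∈) (∈-fromListˢ⁺ y∈) lt

      module _ {top : Vx} {roots : List Vx} (shape : ys ≡ top ∷ roots) where

        dec : Decreasing (top ∷ roots)
        dec = subst Decreasing shape decreasing

        top∈ : top ∈ ys
        top∈ = subst (top ∈_) (sym shape) (here refl)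

        root∈ : ∀ {x} → x ∈ roots → x ∈ ys
        root∈ {x} q = subst (x ∈_) (sym shape) (there q)

        below : ∀ {x} → x ∈ roots → toℕ x < toℕ top
        below q with dec
        ... | h ∷ _ = All.lookup h q

        roots-unique : Unique roots
        roots-unique with Decreasing⇒Unique dec
        ... | _ ∷ u = u

        ≢top : ∀ {x} → x ∈ roots → x ≢ top
        ≢top q refl = <-irrefl refl (below q)

        θ≤ : θ ≤ length roots
        θ≤ = s≤s⁻¹ (≤-trans (m≤m+n (suc θ) _) (≤-reflexive (trans (sym size) (cong length shape))))

        sel = select θ roots-unique θ≤
        root = proj₁ sel
        root-in : ∀ c → root c ∈ roots
        root-in = proj₁ (proj₂ sel)

        bundles : ∀ c → Bundle K (root c) top
        bundles c = bundle (root∈ (root-in c)) top∈ (below (root-in c))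

        root-far : ∀ c → ¬ ShortWalk l (Sub._∈ U) (root c) top
        root-far c = apart (≤-trans (m≤m+n l _) l≤D) (root∈ (root-in c)) top∈ (≢top (root-in c))

        legs≤ : legBound t δ l ≤ K
        legs≤ = ≤-trans (m≤m+n _ _) (≤-trans (m≤n+m _ k) (m≤n+m _ (suc θ)))

        holes≤ : holeBound t l ≤ K
        holes≤ = ≤-trans (m≤n+m _ (legBound t δ l)) (≤-trans (m≤n+m _ k) (m≤n+m _ (suc θ)))

        rooted : RootedStarForestIn G U θ δ l (fromListˢ ys)
        -- The centre is a valid root for every `δ`.
        rooted = F.forest , (λ _ → nothing) , λ c → inj₂ refl , ∈-fromListˢ⁺ (root∈ (root-in c))
          where
            module F = Forest {K} {θ} {δ} {l} {top} root bundles root-far (λ c → ys-U (root∈ (root-in c)))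
              (λ {c} {c'} n → apart l≤D (root∈ (root-in c)) (root∈ (root-in c')) (n ∘ proj₂ (proj₂ sel) c c'))
              (λ c → Legs.star (bundles c) l (root-far c) δ legs≤)

        hole : Σ (Hole G U) λ H → l < Hole.L H
        hole = LongHole.long-hole G t clean U l 1≤l (bundle x∈ top∈ (below x∈roots))
            (apart (≤-trans (+-monoʳ-≤ l (m≤m+n 1 l)) l≤D) top∈ x∈ (≢top x∈roots ∘ sym)) (ys-U x∈) holes≤
          where
            first : ∀ {xs : List Vx} → 1 ≤ length xs → ∃ (_∈ xs)
            first {x ∷ _} _ = x , here refl
            x∈roots = proj₂ (first {roots} (≤-trans 1≤θ θ≤))
            x∈ = root∈ x∈roots

    outcome : StrongBlock G ⊤ (blockBound t D K) B → Outcome G B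
    outcome block = build (scattered K B (proj₁ block))
      where
        build : ∃₂ (Scattered K B) → Outcome G B
        build (A , [] , sc) with Scattered.size sc
        ... | ()
        build (A , top ∷ roots , sc) = fromListˢ A , fromListˢ (top ∷ roots) , (λ {x} → S-sub sc strong {x}) ,
            StrongBlock-≤ (≤-trans (m≤m+n k _) (m≤n+m _ (suc θ))) strong , S-stable sc strong ,
            rooted sc strong refl , hole sc strong refl
          where
            strong : StrongBlock G (∁ (fromListˢ A)) K (fromListˢ (top ∷ roots))
            strong = surviving-block (m≤n+m _ _) sc block

theorem8p1 : (d k t δ l θ : ℕ) → 1 ≤ d → 1 ≤ k → 1 ≤ t → 2 ≤ δ → 1 ≤ l → 1 ≤ θ →
    Σ ℕ λ k₁ → 1 ≤ k₁ ×
    ((G : Graph) → Clean t G → (B₁ : Subset (n G)) → StrongBlock G ⊤ k₁ B₁ →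
    Σ (Subset (n G)) λ A → Σ (Subset (n G)) λ S →
    S ⊆ (B₁ ─ A) ×
    StrongBlock G (∁ A) k S ×
    Stable G (∁ A) d S ×
    RootedStarForestIn G (∁ A) θ δ l S ×
    Σ (Hole G (∁ A)) λ H → l < Hole.L H)
theorem8p1 d k t δ l θ _ _ _ _ 1≤l 1≤θ = blockBound t D K , positive , outcome
  where
    open Assemble d k t δ l θ 1≤l 1≤θ
    positive : 1 ≤ blockBound t D K
    positive = ≤-trans (s≤s z≤n) (≤-trans (m≤m+n K _) (m≤n+m _ _))
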